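{- Let $n\ge 1$, let $\mathcal T=(T_1,\dots,T_n)$ be any tree sequence of order $n$, and let $\mathbf k=(k_1,\dots,k_n)\in\mathbb Z^n$. Then the signed enumeration of Gelfand–Tsetlin tree sequences associated with $\mathcal T$ and $\mathbf k$ is $$L_n(\mathcal T,\mathbf k)=\prod_{1\le i<j\le n}\frac{k_j-k_i+j-i}{j-i}.$$
   Context: An $n$-tree is a directed tree (every edge has an orientation) whose vertex set is $\{1,2,\dots,n\}$ and whose $n-1$ edges are named bijectively by the primed symbols $1',2',\dots,(n-1)'$. A tree sequence of order $n$ is a sequence $\mathcal T=(T_1,\dots,T_n)$ where $T_i$ is an $i$-tree for each $i$. Admissibility: let $T$ be an $n$-tree and $\mathbf k=(k_1,\dots,k_n)\in\mathbb Z^n$. A vector $\mathbf l=(l_1,\dots,l_{n-1})\in\mathbb Z^{n-1}$ is admissible for $(T,\mathbf k)$ if for every edge $j'$ of $T$, directed from vertex $p$ to vertex $q$: if $k_p+p<k_q+q$ then $k_p+p\le l_j+j<k_q+q$, and otherwise $k_q+q\le l_j+j<k_p+p$; in the latter case the edge $j'$ is called an inversion of $(T,\mathbf k)$. (So no admissible vector exists if some edge has $k_p+p=k_q+q$.) Gelfand–Tsetlin tree sequences: given a tree sequence $\mathcal T=(T_1,\dots,T_n)$ and $\mathbf k\in\mathbb Z^n$, a Gelfand–Tsetlin tree sequence is a sequence $\mathbf L=(\mathbf l_1,\dots,\mathbf l_n)$ with $\mathbf l_i\in\mathbb Z^i$, $\mathbf l_n=\mathbf k$, such that $\mathbf l_{i-1}$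 is admissible for $(T_i,\mathbf l_i)$ for $i=2,\dots,n$. Its inversions are the inversions of the pairs $(T_i,\mathbf l_i)$, $i=2,\dots,n$. Sign of an $n$-tree $T$: choose a root vertex $r$; the standard orientation orients every edge away from $r$; an edge is reversed if its orientation in $T$ differs from the standard one. Every non-root vertex is the head (w.r.t. the standard orientation) of exactly one edge; let $\pi$ be the permutation of $\{1,\dots,n\}$ given by $r$ followed by the heads of the edges $1',2',\dots,(n-1)'$ in this order. Then $\operatorname{sgn}T=(-1)^{\#\text{reversed edges}}\operatorname{sgn}\pi$ (this does not depend on the root). The sign of a tree sequence is $\operatorname{sgn}\mathcal T=\prod_{i=1}^n\operatorname{sgn}T_i$. The sign of a Gelfand–Tsetlin tree sequence $\mathbf L$ is $(-1)^{\#\text{inversions of }\mathbf L}\operatorname{sgn}\mathcal T$, and $L_n(\mathcal T,\mathbf k)$ denotes the sum of the signs of all Gelfand–Tsetlin tree sequences associated with $\mathcal T$ and $\mathbf k$. -}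

module Defs where

open import Data.Bool using (Bool; true; false; not; _∧_; _∨_; if_then_else_)
open import Data.Nat as ℕ using (ℕ; zero; suc)
open import Data.Fin as Fin using (Fin; toℕ)
open import Data.Fin.Properties using () renaming (_≟_ to _≟ᶠ_)
open import Data.Integer as ℤ using (ℤ; +_; -[1+_]; _≤ᵇ_)
open import Data.List as List using (List; []; _∷_; map; concatMap; allFin; upTo; foldr; filterᵇ)
open import Data.Vec as Vec using (Vec; lookup)
open import Data.Product using (_×_; _,_)
open import Data.Unit using (⊤; tt)
open import Data.Bool.ListAction using (and)
open import Relation.Nullary.Decidable using (⌊_⌋)

Σℤ : List ℤ → ℤ
Σℤ = foldr ℤ._+_ (+ 0)

Πℤ : List ℤ → ℤ
Πℤ = foldr ℤ._*_ (+ 1)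

Σℕ : List ℕ → ℕ
Σℕ = foldr ℕ._+_ 0

countFin : ∀ {n} → (Fin n → Bool) → ℕ
countFin {n} p = Σℕ (map (λ i → if p i then 1 else 0) (allFin n))

negOnePow : ℕ → ℤ
negOnePow zero = + 1
negOnePow (suc k) = ℤ.- negOnePow k

_<ᵇ_ : ℤ → ℤ → Bool
a <ᵇ b = not (b ≤ᵇ a)

-- n-trees.  An (suc m)-tree has vertex set Fin (suc m) (vertex v stands
-- for the vertex toℕ v + 1) and m edges indexed by Fin m (edge j stands
-- for the edge (toℕ j + 1)').  Edge j is directed from  tail j  to  head j.

data Connected {m : ℕ} (tl hd : Fin m → Fin (suc m)) :
       Fin (suc m) → Fin (suc m) → Set where
  here  : ∀ {u} → Connected tl hd u u
  fwd   : ∀ {u} (j : Fin m) → Connected tl hd u (tl j) → Connected tl hd u (hd j)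
  bwd   : ∀ {u} (j : Fin m) → Connected tl hd u (hd j) → Connected tl hd u (tl j)

-- A directed graph on n = suc m vertices with n - 1 edges is a tree iff
-- its underlying undirected graph is connected.
record Tree (m : ℕ) : Set where
  field
    tail : Fin m → Fin (suc m)
    head : Fin m → Fin (suc m)
    connected : ∀ u v → Connected tail head u v
open Tree public

TreeSeq : ℕ → Set
TreeSeq zero = ⊤
TreeSeq (suc m) = TreeSeq m × Tree m

-- Sign of a tree (root r = vertex 1, i.e. Fin.zero)

module _ {m : ℕ} (T : Tree m) where

  reach : ℕ → Fin (suc m) → Bool
  reach zero v = ⌊ v ≟ᶠ Fin.zero ⌋
  reach (suc s) v =
    reach s v ∨ foldr _∨_ false
      (map (λ j → (⌊ v ≟ᶠ head T j ⌋ ∧ reach s (tail T j))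
                  ∨ (⌊ v ≟ᶠ tail T j ⌋ ∧ reach s (head T j)))
           (allFin m))

  -- graph distance from the root (all vertices are reached in ≤ m steps)
  dist : Fin (suc m) → ℕ
  dist v = Σℕ (map (λ s → if reach s v then 0 else 1) (upTo (suc m)))

  -- head of edge j in the standard orientation (away from the root):
  -- the endpoint farther from the root
  stdHead : Fin m → Fin (suc m)
  stdHead j = if dist (tail T j) ℕ.<ᵇ dist (head T j) then head T j else tail T j

  reversed : ℕ
  reversed = countFin (λ j → not ⌊ stdHead j ≟ᶠ head T j ⌋)

  π : Fin (suc m) → Fin (suc m)
  π Fin.zero = Fin.zero
  π (Fin.suc j) = stdHead j

  πInversions : ℕ
  πInversions = Σℕ (map (λ a → countFin (λ b →
     (toℕ a ℕ.<ᵇ toℕ b) ∧ (toℕ (π b) ℕ.<ᵇ toℕ (π a)))) (allFin (suc m)))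

  sgnTree : ℤ
  sgnTree = negOnePow (reversed ℕ.+ πInversions)

sgnSeq : ∀ {n} → TreeSeq n → ℤ
sgnSeq {zero} tt = + 1
sgnSeq {suc m} (𝒯 , T) = sgnSeq 𝒯 ℤ.* sgnTree T

-- Admissibility.  k : Vec ℤ (suc m) is indexed by vertices, l : Vec ℤ m
-- by edges.  Vertex v has label p = toℕ v + 1, edge j has label toℕ j + 1.

module _ {m : ℕ} (T : Tree m) (k : Vec ℤ (suc m)) where

  kv : Fin (suc m) → ℤ
  kv v = lookup k v ℤ.+ + suc (toℕ v)

  isInversion : Fin m → Bool
  isInversion j = not (kv (tail T j) <ᵇ kv (head T j))

  inversions : ℕ
  inversions = countFin isInversion

  lowE highE : Fin m → ℤ
  lowE j = if isInversion j then kv (head T j) else kv (tail T j)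
  highE j = if isInversion j then kv (tail T j) else kv (head T j)

  admissible : Vec ℤ m → Bool
  admissible l = and (map (λ j →
      (lowE j ≤ᵇ (lookup l j ℤ.+ + suc (toℕ j))) ∧
      ((lookup l j ℤ.+ + suc (toℕ j)) <ᵇ highE j)) (allFin m))

  -- finite candidate list containing every admissible vector:
  -- l_j ranges over [lowE j - j , highE j - j)
  private
    natPart : ℤ → ℕ
    natPart (+ n) = n
    natPart -[1+ _ ] = 0

    rangeℤ : ℤ → ℤ → List ℤ
    rangeℤ lo hi = map (λ i → lo ℤ.+ + i) (upTo (natPart (hi ℤ.- lo)))

    boxes : ∀ {r} → Vec (ℤ × ℤ) r → List (Vec ℤ r)
    boxes Vec.[] = Vec.[] ∷ []
    boxes ((lo , hi) Vec.∷ bs) =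
      concatMap (λ x → map (x Vec.∷_) (boxes bs)) (rangeℤ lo hi)

  candidates : List (Vec ℤ m)
  candidates = boxes (Vec.tabulate (λ j →
      (lowE j ℤ.- + suc (toℕ j)) , (highE j ℤ.- + suc (toℕ j))))

  -- all admissible vectors for (T , k), each listed once
  admissibles : List (Vec ℤ m)
  admissibles = filterᵇ admissible candidates

-- Gelfand–Tsetlin tree sequences.  gtInversions 𝒯 k lists, for every
-- Gelfand–Tsetlin tree sequence L = (l_1,...,l_n) with l_n = k, its total
-- number of inversions (one list entry per sequence).

gtInversions : ∀ {n} → TreeSeq n → Vec ℤ n → List ℕ
gtInversions {zero} tt k = 0 ∷ []
gtInversions {suc zero} (tt , T) k = 0 ∷ []
gtInversions {suc (suc m)} (𝒯 , T) k =
  concatMap (λ l → map (inversions T k ℕ.+_) (gtInversions 𝒯 l)) (admissibles T k)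

Lₙ : ∀ {n} → TreeSeq n → Vec ℤ n → ℤ
Lₙ 𝒯 k = Σℤ (map (λ i → negOnePow i ℤ.* sgnSeq 𝒯) (gtInversions 𝒯 k))

pairsLt : (n : ℕ) → List (Fin n × Fin n)
pairsLt n = concatMap (λ i → map (i ,_)
  (filterᵇ (λ j → toℕ i ℕ.<ᵇ toℕ j) (allFin n))) (allFin n)

numProd : ∀ {n} → Vec ℤ n → ℤ
numProd {n} k = Πℤ (map (λ { (i , j) →
  lookup k j ℤ.- lookup k i ℤ.+ (+ toℕ j ℤ.- + toℕ i) }) (pairsLt n))

denProd : ℕ → ℤ
denProd n = Πℤ (map (λ { (i , j) → + toℕ j ℤ.- + toℕ i }) (pairsLt n))

{-# OPTIONS --safe #-}
-- In the coordinates x v = k v + v the claim reads L = V x / (1! 2! … (n-1)!) with V the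
-- Vandermonde product.  Summing over an edge from p to q, with the sign of its inversion, is
-- integration from x p to x q.  V is a determinant in the falling factorials, hence
-- multilinear in functions of a single coordinate, and integrating each of its m variables
-- turns it, up to the factor m!, into the Vandermonde determinant of order m + 1 whose first
-- row is evaluated at x r for a root r and whose other rows are the differences of the rows
-- x q and x p along the edges.  Expanding these differences, a term survives only
-- if the chosen ends together with r are distinct, which forces every edge to choose its end
-- away from r; the remaining term is V x up to sgn T.
module Submission where

open import Defs
open import Data.Bool as Bool using (Bool; true; false; not; _∧_; _∨_; if_then_else_)
open import Data.Bool.ListAction using (and)
import Data.Bool.Properties as Bool
open import Data.Empty using (⊥)
open import Data.Fin as Fin using (Fin; toℕ)
import Data.Fin.Properties as Fin
open import Data.Integer as ℤ using (ℤ; +_; _+_; _*_; -_; _-_)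
import Data.Integer.Properties as ℤ
open import Data.Integer.Tactic.RingSolver using (solve-∀)
open import Data.List as List
  using (List; []; _∷_; map; allFin; upTo; applyUpTo; foldr; filterᵇ; concatMap)
import Data.List.Properties as List
open import Data.List.Membership.Propositional using (_∈_; find)
open import Data.List.Membership.Propositional.Properties
  using (∈-allFin; ∈-upTo⁺; ∈-upTo⁻; ∈-map⁺; ∈-map⁻; ∈-concatMap⁻)
open import Data.List.Membership.Propositional.Properties.WithK using (unique∧set⇒bag)
open import Data.List.Relation.Binary.BagAndSetEquality using (∼bag⇒↭)
open import Data.List.Relation.Binary.Permutation.Propositional as Perm using (_↭_)
open import Data.List.Relation.Unary.All as All using (All)
open import Data.List.Relation.Unary.Any using (here; there)
open import Data.List.Relation.Unary.Unique.Propositional.Properties using (map⁺; allFin⁺)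
open import Data.Nat as ℕ using (ℕ; zero; suc; s≤s; z≤n)
open import Data.Nat.Induction using (Acc; acc; <-wellFounded)
import Data.Nat.Properties as ℕ
open import Data.Product using (_×_; _,_; ∃; proj₁; proj₂)
open import Data.Sum using (_⊎_; inj₁; inj₂)
open import Data.Unit using (tt)
open import Data.Vec as Vec using (Vec; []; _∷_; tabulate; lookup; toList)
import Data.Vec.Properties as Vec
open import Function using (_∘_; id; mk⇔; Equivalence)
open import Relation.Binary using (tri<; tri≈; tri>)
open import Relation.Binary.PropositionalEquality
open import Relation.Nullary using (Dec; yes; no; ¬_; contradiction)
open import Relation.Nullary.Decidable using (_×-dec_; ⌊_⌋; isYes≗does; dec-true)
open ≡-Reasoning

-- Falling factorials rather than powers form the columns because summation over an integer interval
-- carries `falling k` to `falling (suc k)` up to the factor `suc k`; every identity then stays in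
-- the integers, with denominators multiplied out. The factor m! collects these factors over the
-- columns of degree 1 to m. The passage from order m to m + 1 rests on the column of constants:
-- there the differences along edges have entry 0 and the root row has entry 1, so the larger
-- determinant collapses to the minor formed by the edge rows. Integration along an edge and the
-- difference of its end values both act on a single row. Both are therefore encoded as formal
-- combinations of integers and compared through the multilinear extension of `V`. An inversion sign
-- is the orientation of an integral, so the two cases of admissibility become one formula; an edge
-- whose ends have equal coordinates integrates over an empty interval and contributes zero on both
-- sides.

private variable
  A B X Y : Set
  m n : ℕ

negOnePow-square : ∀ k → negOnePow k * negOnePow k ≡ + 1
negOnePow-square zero = refl
negOnePow-square (suc k) = trans (neg-square (negOnePow k)) (negOnePow-square k)
  where
  neg-square : ∀ a → - a * - a ≡ a * a
  neg-square = solve-∀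

negOnePow-cancel : ∀ k a → negOnePow k * (negOnePow k * a) ≡ a
negOnePow-cancel k a = begin
  negOnePow k * (negOnePow k * a) ≡⟨ ℤ.*-assoc (negOnePow k) (negOnePow k) a ⟨
  negOnePow k * negOnePow k * a   ≡⟨ cong (_* a) (negOnePow-square k) ⟩
  + 1 * a                         ≡⟨ ℤ.*-identityˡ a ⟩
  a                               ∎

-- Alternating sums over deletions

-- ∂ a F (x₀ ∷ … ∷ xₙ) = Σᵢ (-1)ⁱ a xᵢ F (x₀ ∷ … x̂ᵢ … ∷ xₙ), the Laplace
-- expansion of a determinant along a column with entries a xᵢ.
∂ : (X → ℤ) → (Vec X n → ℤ) → Vec X (suc n) → ℤ
∂ {n = zero}  a F (x ∷ []) = a x * F []
∂ {n = suc n} a F (x ∷ xs) = a x * F xs - ∂ a (F ∘ (x ∷_)) xs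

∂-cong : {a b : X → ℤ} {F G : Vec X n → ℤ} → (∀ x → a x ≡ b x) → (∀ xs → F xs ≡ G xs) →
         ∀ xs → ∂ a F xs ≡ ∂ b G xs
∂-cong {n = zero}  a≗b F≗G (x ∷ []) = cong₂ _*_ (a≗b x) (F≗G [])
∂-cong {n = suc n} a≗b F≗G (x ∷ xs) =
  cong₂ _-_ (cong₂ _*_ (a≗b x) (F≗G xs)) (∂-cong a≗b (F≗G ∘ (x ∷_)) xs)

∂-congʳ : (a : X → ℤ) {F G : Vec X n → ℤ} → (∀ xs → F xs ≡ G xs) → ∀ xs → ∂ a F xs ≡ ∂ a G xs
∂-congʳ a = ∂-cong (λ _ → refl)

∂-linear : (a : X → ℤ) (c : ℤ) (F G : Vec X n → ℤ) (xs : Vec X (suc n)) →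
           ∂ a (λ ys → c * F ys + G ys) xs ≡ c * ∂ a F xs + ∂ a G xs
∂-linear {n = zero} a c F G (x ∷ []) = ring (a x) c (F []) (G [])
  where
  ring : ∀ a c f g → a * (c * f + g) ≡ c * (a * f) + a * g
  ring = solve-∀
∂-linear {n = suc n} a c F G (x ∷ xs) = begin
  a x * (c * F xs + G xs) - ∂ a (λ ys → c * F (x ∷ ys) + G (x ∷ ys)) xs
    ≡⟨ cong (λ z → a x * (c * F xs + G xs) - z) (∂-linear a c _ _ xs) ⟩
  a x * (c * F xs + G xs) - (c * ∂ a (F ∘ (x ∷_)) xs + ∂ a (G ∘ (x ∷_)) xs)
    ≡⟨ ring (a x) c (F xs) (G xs) _ _ ⟩
  c * (a x * F xs - ∂ a (F ∘ (x ∷_)) xs) + (a x * G xs - ∂ a (G ∘ (x ∷_)) xs) ∎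
  where
  ring : ∀ a c f g u v → a * (c * f + g) - (c * u + v) ≡ c * (a * f - u) + (a * g - v)
  ring = solve-∀

∂-zero : (a : X → ℤ) (F : Vec X n → ℤ) → (∀ xs → F xs ≡ + 0) → ∀ xs → ∂ a F xs ≡ + 0
∂-zero {n = zero}  a F F≗0 (x ∷ []) = trans (cong (a x *_) (F≗0 [])) (ℤ.*-zeroʳ (a x))
∂-zero {n = suc n} a F F≗0 (x ∷ xs) =
  cong₂ _-_ (trans (cong (a x *_) (F≗0 xs)) (ℤ.*-zeroʳ (a x))) (∂-zero a _ (F≗0 ∘ (x ∷_)) xs)

∂-scale : (a : X → ℤ) (c : ℤ) (F : Vec X n → ℤ) (xs : Vec X (suc n)) →
          ∂ a (λ ys → c * F ys) xs ≡ c * ∂ a F xs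
∂-scale a c F xs = begin
  ∂ a (λ ys → c * F ys) xs                  ≡⟨ ∂-congʳ a (λ ys → sym (ℤ.+-identityʳ _)) xs ⟩
  ∂ a (λ ys → c * F ys + + 0) xs            ≡⟨ ∂-linear a c F (λ _ → + 0) xs ⟩
  c * ∂ a F xs + ∂ a (λ _ → + 0) xs         ≡⟨ cong (_+_ (c * ∂ a F xs)) (∂-zero a _ (λ _ → refl) xs) ⟩
  c * ∂ a F xs + + 0                        ≡⟨ ℤ.+-identityʳ _ ⟩
  c * ∂ a F xs                              ∎

∂-minus : (a : X → ℤ) (c : ℤ) (F G : Vec X n → ℤ) (xs : Vec X (suc n)) →
          ∂ a (λ ys → c * F ys - G ys) xs ≡ c * ∂ a F xs - ∂ a G xs
∂-minus a c F G xs = begin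
  ∂ a (λ ys → c * F ys - G ys) xs
    ≡⟨ ∂-congʳ a (λ ys → cong (_+_ (c * F ys)) (sym (ℤ.-1*i≡-i (G ys)))) xs ⟩
  ∂ a (λ ys → c * F ys + - + 1 * G ys) xs
    ≡⟨ ∂-linear a c F (λ ys → - + 1 * G ys) xs ⟩
  c * ∂ a F xs + ∂ a (λ ys → - + 1 * G ys) xs
    ≡⟨ cong (_+_ (c * ∂ a F xs)) (trans (∂-scale a (- + 1) G xs) (ℤ.-1*i≡-i (∂ a G xs))) ⟩
  c * ∂ a F xs - ∂ a G xs ∎

∂-weight-linear : (a b : X → ℤ) (c : ℤ) (F : Vec X n → ℤ) (xs : Vec X (suc n)) →
                  ∂ (λ x → c * a x + b x) F xs ≡ c * ∂ a F xs + ∂ b F xs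
∂-weight-linear {n = zero} a b c F (x ∷ []) = ring (a x) (b x) c (F [])
  where
  ring : ∀ a b c f → (c * a + b) * f ≡ c * (a * f) + b * f
  ring = solve-∀
∂-weight-linear {n = suc n} a b c F (x ∷ xs) = begin
  (c * a x + b x) * F xs - ∂ (λ y → c * a y + b y) (F ∘ (x ∷_)) xs
    ≡⟨ cong (_-_ ((c * a x + b x) * F xs)) (∂-weight-linear a b c _ xs) ⟩
  (c * a x + b x) * F xs - (c * ∂ a (F ∘ (x ∷_)) xs + ∂ b (F ∘ (x ∷_)) xs)
    ≡⟨ ring (a x) (b x) c (F xs) _ _ ⟩
  c * (a x * F xs - ∂ a (F ∘ (x ∷_)) xs) + (b x * F xs - ∂ b (F ∘ (x ∷_)) xs) ∎
  where
  ring : ∀ a b c f u v → (c * a + b) * f - (c * u + v) ≡ c * (a * f - u) + (b * f - v)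
  ring = solve-∀

∂-weight-zero : (a : X → ℤ) (F : Vec X n → ℤ) → (∀ x → a x ≡ + 0) → ∀ xs → ∂ a F xs ≡ + 0
∂-weight-zero {n = zero}  a F a≗0 (x ∷ []) = cong (_* F []) (a≗0 x)
∂-weight-zero {n = suc n} a F a≗0 (x ∷ xs) =
  cong₂ _-_ (cong (_* F xs) (a≗0 x)) (∂-weight-zero a _ a≗0 xs)

∂-weight-scale : (a : X → ℤ) (c : ℤ) (F : Vec X n → ℤ) (xs : Vec X (suc n)) →
                 ∂ (λ x → c * a x) F xs ≡ c * ∂ a F xs
∂-weight-scale a c F xs = begin
  ∂ (λ x → c * a x) F xs             ≡⟨ ∂-cong (λ _ → sym (ℤ.+-identityʳ _)) (λ _ → refl) xs ⟩
  ∂ (λ x → c * a x + + 0) F xs       ≡⟨ ∂-weight-linear a (λ _ → + 0) c F xs ⟩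
  c * ∂ a F xs + ∂ (λ _ → + 0) F xs  ≡⟨ cong (_+_ (c * ∂ a F xs)) (∂-weight-zero _ F (λ _ → refl) xs) ⟩
  c * ∂ a F xs + + 0                 ≡⟨ ℤ.+-identityʳ _ ⟩
  c * ∂ a F xs                       ∎

∂-map : (f : X → Y) (a : Y → ℤ) (F : Vec Y n → ℤ) (xs : Vec X (suc n)) →
        ∂ a F (Vec.map f xs) ≡ ∂ (a ∘ f) (F ∘ Vec.map f) xs
∂-map {n = zero}  f a F (x ∷ []) = refl
∂-map {n = suc n} f a F (x ∷ xs) = cong (_-_ (a (f x) * F (Vec.map f xs))) (∂-map f a (F ∘ (f x ∷_)) xs)

-- Both sides delete two entries. Deleting the earlier one first lowers the position of the later
-- one by one, which flips the sign of every term.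
∂-anticomm : (a b : X → ℤ) (F : Vec X n → ℤ) (xs : Vec X (suc (suc n))) →
             ∂ a (∂ b F) xs ≡ - ∂ b (∂ a F) xs
∂-anticomm {n = zero} a b F (x ∷ y ∷ []) = ring (a x) (b y) (a y) (b x) (F [])
  where
  ring : ∀ p q r s f → p * (q * f) - r * (s * f) ≡ - (s * (r * f) - q * (p * f))
  ring = solve-∀
∂-anticomm {n = suc n} a b F (x ∷ xs) = begin
  a x * ∂ b F xs - ∂ a (λ ys → b x * F ys - ∂ b (F ∘ (x ∷_)) ys) xs
    ≡⟨ cong (λ z → a x * ∂ b F xs - z) (∂-minus a (b x) F (∂ b (F ∘ (x ∷_))) xs) ⟩
  a x * ∂ b F xs - (b x * ∂ a F xs - ∂ a (∂ b (F ∘ (x ∷_))) xs)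
    ≡⟨ cong (λ z → a x * ∂ b F xs - (b x * ∂ a F xs - z)) (∂-anticomm a b _ xs) ⟩
  a x * ∂ b F xs - (b x * ∂ a F xs - (- ∂ b (∂ a (F ∘ (x ∷_))) xs))
    ≡⟨ ring (a x * ∂ b F xs) (b x * ∂ a F xs) _ ⟩
  - (b x * ∂ a F xs - (a x * ∂ b F xs - ∂ b (∂ a (F ∘ (x ∷_))) xs))
    ≡⟨ cong (λ z → - (b x * ∂ a F xs - z)) (∂-minus b (a x) F (∂ a (F ∘ (x ∷_))) xs) ⟨
  - (b x * ∂ a F xs - ∂ b (λ ys → a x * F ys - ∂ a (F ∘ (x ∷_)) ys) xs) ∎
  where
  ring : ∀ p q u → p - (q - (- u)) ≡ - (q - (p - u))
  ring = solve-∀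

-- The Vandermonde product

pairProd : (X → X → ℤ) → List X → ℤ
pairProd e []       = + 1
pairProd e (x ∷ xs) = Πℤ (map (e x) xs) * pairProd e xs

V : Vec ℤ n → ℤ
V xs = pairProd (λ x y → y - x) (toList xs)

-- The weight `h y` restores the factor of the deleted entry, so every term carries the product over
-- the whole vector.
∂-Π : (h g : ℤ → ℤ) (F : Vec ℤ n → ℤ) (xs : Vec ℤ (suc n)) →
      ∂ (λ y → h y * g y) (λ ys → Πℤ (map h (toList ys)) * F ys) xs
        ≡ Πℤ (map h (toList xs)) * ∂ g F xs
∂-Π {n = zero} h g F (x ∷ []) = ring (h x) (g x) (F [])
  where
  ring : ∀ h g f → h * g * (+ 1 * f) ≡ h * + 1 * (g * f)
  ring = solve-∀
∂-Π {n = suc n} h g F (x ∷ xs) = begin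
  h x * g x * (Πℤ (map h (toList xs)) * F xs)
    - ∂ (λ y → h y * g y) (λ ys → h x * Πℤ (map h (toList ys)) * F (x ∷ ys)) xs
    ≡⟨ cong (λ z → h x * g x * (Πℤ (map h (toList xs)) * F xs) - z)
         (trans (∂-congʳ _ (λ ys → ℤ.*-assoc (h x) _ _) xs)
           (trans (∂-scale _ (h x) _ xs) (cong (h x *_) (∂-Π h g _ xs)))) ⟩
  h x * g x * (Πℤ (map h (toList xs)) * F xs)
    - h x * (Πℤ (map h (toList xs)) * ∂ g (F ∘ (x ∷_)) xs)
    ≡⟨ ring (h x) (g x) (Πℤ (map h (toList xs))) (F xs) _ ⟩
  h x * Πℤ (map h (toList xs)) * (g x * F xs - ∂ g (F ∘ (x ∷_)) xs) ∎
  where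
  ring : ∀ h g p f u → h * g * (p * f) - h * (p * u) ≡ h * p * (g * f - u)
  ring = solve-∀

-- Split y - c = (y - x) + (x - c): the first summand absorbs the factors of V that involve x.
∂V-step : (g : ℤ → ℤ) (c x : ℤ) (xs : Vec ℤ (suc n)) →
          ∂ (λ y → g y * (y - c)) V (x ∷ xs)
            ≡ (x - c) * ∂ g V (x ∷ xs) - Πℤ (map (λ y → y - x) (toList xs)) * ∂ g V xs
∂V-step g c x xs = begin
  g x * (x - c) * V xs - ∂ (λ y → g y * (y - c)) (V ∘ (x ∷_)) xs
    ≡⟨ cong (λ z → g x * (x - c) * V xs - z) (begin
         ∂ (λ y → g y * (y - c)) (V ∘ (x ∷_)) xs
           ≡⟨ ∂-cong (λ y → split x c y (g y)) (λ _ → refl) xs ⟩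
         ∂ (λ y → (x - c) * g y + (y - x) * g y) (V ∘ (x ∷_)) xs
           ≡⟨ ∂-weight-linear g (λ y → (y - x) * g y) (x - c) _ xs ⟩
         (x - c) * ∂ g (V ∘ (x ∷_)) xs + ∂ (λ y → (y - x) * g y) (V ∘ (x ∷_)) xs
           ≡⟨ cong (_+_ ((x - c) * ∂ g (V ∘ (x ∷_)) xs)) (∂-Π (λ y → y - x) g V xs) ⟩
         (x - c) * ∂ g (V ∘ (x ∷_)) xs + Πℤ (map (λ y → y - x) (toList xs)) * ∂ g V xs ∎) ⟩
  g x * (x - c) * V xs
    - ((x - c) * ∂ g (V ∘ (x ∷_)) xs + Πℤ (map (λ y → y - x) (toList xs)) * ∂ g V xs)
    ≡⟨ ring (g x) (x - c) (V xs) _ _ ⟩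
  (x - c) * (g x * V xs - ∂ g (V ∘ (x ∷_)) xs) - Πℤ (map (λ y → y - x) (toList xs)) * ∂ g V xs ∎
  where
  split : ∀ x c y g → g * (y - c) ≡ (x - c) * g + (y - x) * g
  split = solve-∀
  ring : ∀ g d v u w → g * d * v - (d * u + w) ≡ d * (g * v - u) - w
  ring = solve-∀

falling : ℕ → ℤ → ℤ
falling zero    x = + 1
falling (suc k) x = falling k x * (x - + k)

mutual
  -- This is a determinant with a repeated column. In degree zero, `V` of the shorter vectors is
  -- replaced by its expansion along the top column; the two expansions anticommute, which leaves
  -- the constant case for one entry fewer. Higher degrees reduce to the preceding degree by
  -- `∂V-step` with c = d.
  ∂V-low : ∀ d n → d ℕ.< n → (xs : Vec ℤ (suc n)) → ∂ (falling d) V xs ≡ + 0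
  ∂V-low zero (suc zero) _ (x ∷ y ∷ []) = refl
  ∂V-low zero (suc (suc n)) _ xs = begin
    ∂ (falling 0) V xs
      ≡⟨ ∂-congʳ _ (λ ys → sym (trans (cong (negOnePow (suc n) *_) (∂V-top (suc n) ys))
                                  (negOnePow-cancel (suc n) (V ys)))) xs ⟩
    ∂ (falling 0) (λ ys → negOnePow (suc n) * ∂ (falling (suc n)) V ys) xs
      ≡⟨ ∂-scale _ (negOnePow (suc n)) _ xs ⟩
    negOnePow (suc n) * ∂ (falling 0) (∂ (falling (suc n)) V) xs
      ≡⟨ cong (negOnePow (suc n) *_) (∂-anticomm _ _ V xs) ⟩
    negOnePow (suc n) * - ∂ (falling (suc n)) (∂ (falling 0) V) xs
      ≡⟨ cong (λ z → negOnePow (suc n) * - z)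
           (∂-zero (falling (suc n)) _ (∂V-low 0 (suc n) (s≤s z≤n)) xs) ⟩
    negOnePow (suc n) * + 0
      ≡⟨ ℤ.*-zeroʳ (negOnePow (suc n)) ⟩
    + 0 ∎
  ∂V-low (suc d) (suc n) (s≤s d<n) (x ∷ xs) = begin
    ∂ (falling (suc d)) V (x ∷ xs)
      ≡⟨ ∂V-step (falling d) (+ d) x xs ⟩
    (x - + d) * ∂ (falling d) V (x ∷ xs) - Πℤ (map (λ y → y - x) (toList xs)) * ∂ (falling d) V xs
      ≡⟨ cong₂ (λ u v → (x - + d) * u - Πℤ (map (λ y → y - x) (toList xs)) * v)
           (∂V-low d (suc n) (s≤s (ℕ.<⇒≤ d<n)) (x ∷ xs)) (∂V-low d n d<n xs) ⟩
    (x - + d) * + 0 - Πℤ (map (λ y → y - x) (toList xs)) * + 0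
      ≡⟨ cong₂ _-_ (ℤ.*-zeroʳ (x - + d)) (ℤ.*-zeroʳ (Πℤ (map (λ y → y - x) (toList xs)))) ⟩
    + 0 ∎

  -- In `∂V-step` the first term vanishes by `∂V-low`, and the product in the second supplies the
  -- factors of `V` that involve x. Each new entry contributes one minus sign.
  ∂V-top : ∀ n (xs : Vec ℤ (suc n)) → ∂ (falling n) V xs ≡ negOnePow n * V xs
  ∂V-top zero (x ∷ []) = refl
  ∂V-top (suc n) (x ∷ xs) = begin
    ∂ (falling (suc n)) V (x ∷ xs)
      ≡⟨ ∂V-step (falling n) (+ n) x xs ⟩
    (x - + n) * ∂ (falling n) V (x ∷ xs) - Πℤ (map (λ y → y - x) (toList xs)) * ∂ (falling n) V xs
      ≡⟨ cong₂ (λ u v → (x - + n) * u - Πℤ (map (λ y → y - x) (toList xs)) * v)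
           (∂V-low n (suc n) (s≤s ℕ.≤-refl) (x ∷ xs)) (∂V-top n xs) ⟩
    (x - + n) * + 0 - Πℤ (map (λ y → y - x) (toList xs)) * (negOnePow n * V xs)
      ≡⟨ ring (x - + n) (Πℤ (map (λ y → y - x) (toList xs))) (negOnePow n) (V xs) ⟩
    - negOnePow n * (Πℤ (map (λ y → y - x) (toList xs)) * V xs) ∎
    where
    ring : ∀ a p s v → a * + 0 - p * (s * v) ≡ - s * (p * v)
    ring = solve-∀

-- Formal linear combinations

Comb : Set → Set
Comb A = List (ℤ × A)

apply : Comb A → (A → ℤ) → ℤ
apply []            f = + 0
apply ((c , a) ∷ φ) f = c * f a + apply φ f

apply-cong : (φ : Comb A) {f g : A → ℤ} → (∀ a → f a ≡ g a) → apply φ f ≡ apply φ g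
apply-cong []            f≗g = refl
apply-cong ((c , a) ∷ φ) f≗g = cong₂ (λ u v → c * u + v) (f≗g a) (apply-cong φ f≗g)

apply-minus : (φ : Comb A) (f g : A → ℤ) → apply φ (λ a → f a - g a) ≡ apply φ f - apply φ g
apply-minus []            f g = refl
apply-minus ((c , a) ∷ φ) f g = begin
  c * (f a - g a) + apply φ (λ a → f a - g a)  ≡⟨ cong (_+_ (c * (f a - g a))) (apply-minus φ f g) ⟩
  c * (f a - g a) + (apply φ f - apply φ g)    ≡⟨ ring c (f a) (g a) (apply φ f) (apply φ g) ⟩
  c * f a + apply φ f - (c * g a + apply φ g)  ∎
  where
  ring : ∀ c f g u v → c * (f - g) + (u - v) ≡ c * f + u - (c * g + v)
  ring = solve-∀

apply-scaleʳ : (φ : Comb A) (f : A → ℤ) (c : ℤ) → apply φ (λ a → f a * c) ≡ apply φ f * c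
apply-scaleʳ []            f c = refl
apply-scaleʳ ((d , a) ∷ φ) f c = begin
  d * (f a * c) + apply φ (λ a → f a * c)  ≡⟨ cong (_+_ (d * (f a * c))) (apply-scaleʳ φ f c) ⟩
  d * (f a * c) + apply φ f * c            ≡⟨ ring d (f a) c (apply φ f) ⟩
  (d * f a + apply φ f) * c                ∎
  where
  ring : ∀ d f c u → d * (f * c) + u * c ≡ (d * f + u) * c
  ring = solve-∀

apply-scaleˡ : (φ : Comb A) (c : ℤ) (f : A → ℤ) → apply φ (λ a → c * f a) ≡ c * apply φ f
apply-scaleˡ φ c f = begin
  apply φ (λ a → c * f a)  ≡⟨ apply-cong φ (λ a → ℤ.*-comm c (f a)) ⟩
  apply φ (λ a → f a * c)  ≡⟨ apply-scaleʳ φ f c ⟩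
  apply φ f * c            ≡⟨ ℤ.*-comm (apply φ f) c ⟩
  c * apply φ f            ∎

-- Multilinear extension of F to formal linear combinations.
ev : (Vec A n → ℤ) → Vec (Comb A) n → ℤ
ev F []       = F []
ev F (φ ∷ φs) = apply φ (λ a → ev (F ∘ (a ∷_)) φs)

ev-cong : {F G : Vec A n → ℤ} → (∀ xs → F xs ≡ G xs) → ∀ φs → ev F φs ≡ ev G φs
ev-cong F≗G []       = F≗G []
ev-cong F≗G (φ ∷ φs) = apply-cong φ (λ a → ev-cong (F≗G ∘ (a ∷_)) φs)

ev-scale : (c : ℤ) (F : Vec A n → ℤ) (φs : Vec (Comb A) n) → ev (λ xs → c * F xs) φs ≡ c * ev F φs
ev-scale c F []       = refl
ev-scale c F (φ ∷ φs) = trans (apply-cong φ (λ a → ev-scale c _ φs)) (apply-scaleˡ φ c _)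

ev-minus : (F G : Vec A n → ℤ) (φs : Vec (Comb A) n) →
           ev (λ xs → F xs - G xs) φs ≡ ev F φs - ev G φs
ev-minus F G []       = refl
ev-minus F G (φ ∷ φs) = trans (apply-cong φ (λ a → ev-minus _ _ φs)) (apply-minus φ _ _)

∂-apply : (w : X → ℤ) (φ : Comb A) (F : A → Vec X n → ℤ) (xs : Vec X (suc n)) →
          ∂ w (λ ys → apply φ (λ a → F a ys)) xs ≡ apply φ (λ a → ∂ w (F a) xs)
∂-apply w []            F xs = ∂-zero w _ (λ _ → refl) xs
∂-apply w ((c , a) ∷ φ) F xs =
  trans (∂-linear w c (F a) (λ ys → apply φ (λ a → F a ys)) xs)
        (cong (_+_ (c * ∂ w (F a) xs)) (∂-apply w φ F xs))

-- Each term of the expansion uses every variable exactly once, in `g` or in `F`, so the linear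
-- extension may be taken slot by slot.
ev-∂ : (g : A → ℤ) (F : Vec A n → ℤ) (φs : Vec (Comb A) (suc n)) →
       ev (∂ g F) φs ≡ ∂ (λ φ → apply φ g) (ev F) φs
ev-∂ {n = zero}  g F (φ ∷ []) = apply-scaleʳ φ g (F [])
ev-∂ {n = suc n} g F (φ ∷ φs) = begin
  apply φ (λ a → ev (λ ys → g a * F ys - ∂ g (F ∘ (a ∷_)) ys) φs)
    ≡⟨ apply-cong φ (λ a → trans (ev-minus (λ ys → g a * F ys) (∂ g (F ∘ (a ∷_))) φs)
         (cong₂ _-_ (ev-scale (g a) F φs) (ev-∂ g (F ∘ (a ∷_)) φs))) ⟩
  apply φ (λ a → g a * ev F φs - ∂ (λ φ → apply φ g) (ev (F ∘ (a ∷_))) φs)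
    ≡⟨ apply-minus φ (λ a → g a * ev F φs) (λ a → ∂ (λ φ → apply φ g) (ev (F ∘ (a ∷_))) φs) ⟩
  apply φ (λ a → g a * ev F φs) - apply φ (λ a → ∂ (λ φ → apply φ g) (ev (F ∘ (a ∷_))) φs)
    ≡⟨ cong₂ _-_ (apply-scaleʳ φ g (ev F φs)) (sym (∂-apply (λ φ → apply φ g) φ _ φs)) ⟩
  apply φ g * ev F φs - ∂ (λ φ → apply φ g) (λ φs → ev F (φ ∷ φs)) φs ∎

-- Determinant of the matrix with rows (apply φ (falling 0), …, apply φ (falling (n - 1))),
-- expanded along its last column and with the sign convention of ∂.
det : Vec (Comb ℤ) n → ℤ
det {n = zero}  _ = + 1
det {n = suc n}   = ∂ (λ φ → apply φ (falling n)) det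

-- This is (-1)^(n(n-1)/2): an expansion along the column of degree k that starts with a plus sign
-- is off by (-1)^k.
detSign : ℕ → ℤ
detSign zero    = + 1
detSign (suc n) = negOnePow n * detSign n

ev-V : (φs : Vec (Comb ℤ) n) → ev V φs ≡ detSign n * det φs
ev-V {n = zero}  []  = refl
ev-V {n = suc n} φs = begin
  ev V φs
    ≡⟨ ev-cong (λ xs → sym (trans (cong (negOnePow n *_) (∂V-top n xs)) (negOnePow-cancel n (V xs)))) φs ⟩
  ev (λ xs → negOnePow n * ∂ (falling n) V xs) φs
    ≡⟨ ev-scale (negOnePow n) (∂ (falling n) V) φs ⟩
  negOnePow n * ev (∂ (falling n) V) φs
    ≡⟨ cong (negOnePow n *_) (ev-∂ (falling n) V φs) ⟩
  negOnePow n * ∂ (λ φ → apply φ (falling n)) (ev V) φs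
    ≡⟨ cong (negOnePow n *_) (trans (∂-congʳ _ ev-V φs) (∂-scale _ (detSign n) det φs)) ⟩
  negOnePow n * (detSign n * det φs)
    ≡⟨ ℤ.*-assoc (negOnePow n) (detSign n) (det φs) ⟨
  detSign (suc n) * det φs ∎

-- Determinants with integrated rows

factorial : ℕ → ℤ
factorial zero    = + 1
factorial (suc n) = + suc n * factorial n

-- The rows φ x integrate the rows ψ x discretely, so that apart from φ₀ the first column vanishes.
module Antidifference
  (φ ψ : X → Comb ℤ) (φ₀ : Comb ℤ)
  (φ-const : ∀ x → apply (φ x) (falling 0) ≡ + 0)
  (φ-falling : ∀ x k → apply (φ x) (falling (suc k)) ≡ + suc k * apply (ψ x) (falling k))
  (φ₀-const : apply φ₀ (falling 0) ≡ + 1)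
  where

  -- The zero column of constants survives in every minor, down to the last one, where it is the
  -- only column.
  det-φ : (xs : Vec X (suc n)) → det (Vec.map φ xs) ≡ + 0
  det-φ {n = zero}  xs = trans (∂-map φ _ _ xs) (∂-weight-zero _ _ φ-const xs)
  det-φ {n = suc n} xs = trans (∂-map φ _ _ xs) (∂-zero _ _ det-φ xs)

  -- In the expansion along the last column, deleting `φ₀` leaves a minor with a zero column.
  -- Deleting another row skips position 0, which costs a sign, and its entry supplies the factor
  -- `suc n` of the factorial.
  det-φ₀∷φ : (xs : Vec X n) →
             det (φ₀ ∷ Vec.map φ xs) ≡ negOnePow n * factorial n * det (Vec.map ψ xs)
  det-φ₀∷φ {n = zero}  [] = cong (_* + 1) φ₀-const
  det-φ₀∷φ {n = suc n} xs = begin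
    apply φ₀ (falling (suc n)) * det (Vec.map φ xs) - ∂ w (λ φs → det (φ₀ ∷ φs)) (Vec.map φ xs)
      ≡⟨ cong₂ (λ u v → apply φ₀ (falling (suc n)) * u - v) (det-φ xs) (begin
        ∂ w (λ φs → det (φ₀ ∷ φs)) (Vec.map φ xs)
          ≡⟨ ∂-map φ w _ xs ⟩
        ∂ (w ∘ φ) (λ ys → det (φ₀ ∷ Vec.map φ ys)) xs
          ≡⟨ ∂-cong (λ x → φ-falling x n) det-φ₀∷φ xs ⟩
        ∂ (λ x → + suc n * apply (ψ x) (falling n))
          (λ ys → negOnePow n * factorial n * det (Vec.map ψ ys)) xs
          ≡⟨ ∂-weight-scale (λ x → apply (ψ x) (falling n)) (+ suc n) _ xs ⟩
        + suc n * ∂ (λ x → apply (ψ x) (falling n))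
          (λ ys → negOnePow n * factorial n * det (Vec.map ψ ys)) xs
          ≡⟨ cong (+ suc n *_) (∂-scale _ (negOnePow n * factorial n) _ xs) ⟩
        + suc n * (negOnePow n * factorial n
          * ∂ (λ x → apply (ψ x) (falling n)) (λ ys → det (Vec.map ψ ys)) xs)
          ≡⟨ cong (λ z → + suc n * (negOnePow n * factorial n * z))
               (∂-map ψ (λ φ → apply φ (falling n)) det xs) ⟨
        + suc n * (negOnePow n * factorial n * det (Vec.map ψ xs)) ∎) ⟩
    apply φ₀ (falling (suc n)) * + 0 - + suc n * (negOnePow n * factorial n * det (Vec.map ψ xs))
      ≡⟨ ring (apply φ₀ (falling (suc n))) (+ suc n) (negOnePow n) (factorial n) (det (Vec.map ψ xs)) ⟩
    - negOnePow n * (+ suc n * factorial n) * det (Vec.map ψ xs) ∎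
    where
    w : Comb ℤ → ℤ
    w φ = apply φ (falling (suc n))
    ring : ∀ a c s f d → a * + 0 - c * (s * f * d) ≡ - s * (c * f) * d
    ring = solve-∀

  -- The sign `negOnePow n` of `det-φ₀∷φ` is exactly the quotient of `detSign (suc n)` and
  -- `detSign n`, so the sign conventions disappear from the result.
  ev-V-φ₀∷φ : (xs : Vec X n) → ev V (φ₀ ∷ Vec.map φ xs) ≡ factorial n * ev V (Vec.map ψ xs)
  ev-V-φ₀∷φ {n = n} xs = begin
    ev V (φ₀ ∷ Vec.map φ xs)
      ≡⟨ ev-V (φ₀ ∷ Vec.map φ xs) ⟩
    negOnePow n * detSign n * det (φ₀ ∷ Vec.map φ xs)
      ≡⟨ cong (negOnePow n * detSign n *_) (det-φ₀∷φ xs) ⟩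
    negOnePow n * detSign n * (negOnePow n * factorial n * det (Vec.map ψ xs))
      ≡⟨ ring (negOnePow n) (detSign n) (factorial n) (det (Vec.map ψ xs)) ⟩
    negOnePow n * (negOnePow n * (factorial n * (detSign n * det (Vec.map ψ xs))))
      ≡⟨ negOnePow-cancel n _ ⟩
    factorial n * (detSign n * det (Vec.map ψ xs))
      ≡⟨ cong (factorial n *_) (ev-V (Vec.map ψ xs)) ⟨
    factorial n * ev V (Vec.map ψ xs) ∎
    where
    ring : ∀ s t f d → s * t * (s * f * d) ≡ s * (s * (f * (t * d)))
    ring = solve-∀

-- Differences of falling factorials

-- `falling` grows by its last factor. Splitting off the first one instead exhibits the factor
-- `falling k x` shared by the values at x and x + 1.
falling-suc : ∀ k x → falling (suc k) (x + + 1) ≡ (x + + 1) * falling k x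
falling-suc zero    x = ring x
  where
  ring : ∀ x → + 1 * (x + + 1 - + 0) ≡ (x + + 1) * + 1
  ring = solve-∀
falling-suc (suc k) x = begin
  falling (suc k) (x + + 1) * (x + + 1 - + suc k)
    ≡⟨ cong₂ _*_ (falling-suc k x) (cong (λ z → x + + 1 - z) (ℤ.+-comm (+ 1) (+ k))) ⟩
  (x + + 1) * falling k x * (x + + 1 - (+ k + + 1))
    ≡⟨ ring x (falling k x) (+ k) ⟩
  (x + + 1) * (falling k x * (x - + k)) ∎
  where
  ring : ∀ x f k → (x + + 1) * f * (x + + 1 - (k + + 1)) ≡ (x + + 1) * (f * (x - k))
  ring = solve-∀

falling-difference : ∀ k x → falling (suc k) (x + + 1) - falling (suc k) x ≡ + suc k * falling k x
falling-difference k x = begin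
  falling (suc k) (x + + 1) - falling k x * (x - + k)
    ≡⟨ cong (_- falling k x * (x - + k)) (falling-suc k x) ⟩
  (x + + 1) * falling k x - falling k x * (x - + k)
    ≡⟨ ring x (falling k x) (+ k) ⟩
  (+ 1 + + k) * falling k x ∎
  where
  ring : ∀ x f k → (x + + 1) * f - f * (x - k) ≡ (+ 1 + k) * f
  ring = solve-∀

-- Finite sums and products, sums over intervals

Σ-scale : (c : ℤ) (f : A → ℤ) (l : List A) → Σℤ (map (λ a → c * f a) l) ≡ c * Σℤ (map f l)
Σ-scale c f []      = sym (ℤ.*-zeroʳ c)
Σ-scale c f (a ∷ l) = trans (cong (_+_ (c * f a)) (Σ-scale c f l)) (sym (ℤ.*-distribˡ-+ c _ _))

Σ-++ : (l l′ : List ℤ) → Σℤ (l List.++ l′) ≡ Σℤ l + Σℤ l′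
Σ-++ []      l′ = sym (ℤ.+-identityˡ _)
Σ-++ (a ∷ l) l′ = trans (cong (_+_ a) (Σ-++ l l′)) (sym (ℤ.+-assoc a _ _))

Σ-concatMap : (f : B → ℤ) (g : A → List B) (l : List A) →
              Σℤ (map f (List.concatMap g l)) ≡ Σℤ (map (λ a → Σℤ (map f (g a))) l)
Σ-concatMap f g []      = refl
Σ-concatMap f g (a ∷ l) = begin
  Σℤ (map f (g a List.++ List.concatMap g l))
    ≡⟨ cong Σℤ (List.map-++ f (g a) _) ⟩
  Σℤ (map f (g a) List.++ map f (List.concatMap g l))
    ≡⟨ Σ-++ (map f (g a)) _ ⟩
  Σℤ (map f (g a)) + Σℤ (map f (List.concatMap g l))
    ≡⟨ cong (_+_ (Σℤ (map f (g a)))) (Σ-concatMap f g l) ⟩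
  Σℤ (map f (g a)) + Σℤ (map (λ a → Σℤ (map f (g a))) l) ∎

Π-++ : (l l′ : List ℤ) → Πℤ (l List.++ l′) ≡ Πℤ l * Πℤ l′
Π-++ []      l′ = sym (ℤ.*-identityˡ _)
Π-++ (a ∷ l) l′ = trans (cong (a *_) (Π-++ l l′)) (sym (ℤ.*-assoc a _ _))

Π-concatMap : (f : B → ℤ) (g : A → List B) (l : List A) →
              Πℤ (map f (List.concatMap g l)) ≡ Πℤ (map (λ a → Πℤ (map f (g a))) l)
Π-concatMap f g []      = refl
Π-concatMap f g (a ∷ l) = begin
  Πℤ (map f (g a List.++ List.concatMap g l))
    ≡⟨ cong Πℤ (List.map-++ f (g a) _) ⟩
  Πℤ (map f (g a) List.++ map f (List.concatMap g l))
    ≡⟨ Π-++ (map f (g a)) _ ⟩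
  Πℤ (map f (g a)) * Πℤ (map f (List.concatMap g l))
    ≡⟨ cong (Πℤ (map f (g a)) *_) (Π-concatMap f g l) ⟩
  Πℤ (map f (g a)) * Πℤ (map (λ a → Πℤ (map f (g a))) l) ∎

Π-allFin-suc : (f : Fin (suc n) → ℤ) →
               Πℤ (map f (allFin (suc n))) ≡ f Fin.zero * Πℤ (map (f ∘ Fin.suc) (allFin n))
Π-allFin-suc f = cong (λ l → f Fin.zero * Πℤ l)
  (trans (List.map-tabulate Fin.suc f) (sym (List.map-tabulate id (f ∘ Fin.suc))))

weighted : ℤ → List A → Comb A
weighted ε = map (ε ,_)

apply-weighted : (ε : ℤ) (l : List A) (f : A → ℤ) → apply (weighted ε l) f ≡ ε * Σℤ (map f l)
apply-weighted ε []      f = sym (ℤ.*-zeroʳ ε)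
apply-weighted ε (a ∷ l) f =
  trans (cong (_+_ (ε * f a)) (apply-weighted ε l f)) (sym (ℤ.*-distribˡ-+ ε _ _))

interval : ℤ → ℕ → List ℤ
interval lo n = map (λ i → lo + + i) (upTo n)

Σ-interval : (f : ℤ → ℤ) (lo : ℤ) (n : ℕ) →
             Σℤ (map f (interval lo n)) ≡ Σℤ (applyUpTo (λ i → f (lo + + i)) n)
Σ-interval f lo n = cong Σℤ
  (trans (sym (List.map-∘ (upTo n))) (List.map-upTo (λ i → f (lo + + i)) n))

Σ-telescope : (u : ℕ → ℤ) (n : ℕ) → Σℤ (applyUpTo (λ i → u (suc i) - u i) n) ≡ u n - u 0
Σ-telescope u zero    = sym (ℤ.+-inverseʳ (u 0))
Σ-telescope u (suc n) = trans (cong (_+_ (u 1 - u 0)) (Σ-telescope (u ∘ suc) n)) (ring (u 1) (u 0) (u (suc n)))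
  where
  ring : ∀ a b c → a - b + (c - a) ≡ c - b
  ring = solve-∀

Σ-falling : (k : ℕ) (lo : ℤ) (n : ℕ) →
            + suc k * Σℤ (map (falling k) (interval lo n))
              ≡ falling (suc k) (lo + + n) - falling (suc k) lo
Σ-falling k lo n = begin
  + suc k * Σℤ (map (falling k) (interval lo n))
    ≡⟨ Σ-scale (+ suc k) (falling k) (interval lo n) ⟨
  Σℤ (map (λ x → + suc k * falling k x) (interval lo n))
    ≡⟨ Σ-interval _ lo n ⟩
  Σℤ (applyUpTo (λ i → + suc k * falling k (lo + + i)) n)
    ≡⟨ cong Σℤ (applyUpTo-cong (λ i → sym (trans
         (cong (λ z → falling (suc k) z - falling (suc k) (lo + + i)) (shift i))
         (falling-difference k (lo + + i)))) n) ⟩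
  Σℤ (applyUpTo (λ i → falling (suc k) (lo + + suc i) - falling (suc k) (lo + + i)) n)
    ≡⟨ Σ-telescope (λ i → falling (suc k) (lo + + i)) n ⟩
  falling (suc k) (lo + + n) - falling (suc k) (lo + + 0)
    ≡⟨ cong (λ z → falling (suc k) (lo + + n) - falling (suc k) z) (ℤ.+-identityʳ lo) ⟩
  falling (suc k) (lo + + n) - falling (suc k) lo ∎
  where
  shift : ∀ i → lo + + suc i ≡ lo + + i + + 1
  shift i = trans (cong (_+_ lo) (ℤ.+-comm (+ 1) (+ i))) (sym (ℤ.+-assoc lo (+ i) (+ 1)))
  applyUpTo-cong : {f g : ℕ → ℤ} → (∀ i → f i ≡ g i) → ∀ n → applyUpTo f n ≡ applyUpTo g n
  applyUpTo-cong f≗g zero    = refl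
  applyUpTo-cong f≗g (suc n) = cong₂ _∷_ (f≗g 0) (applyUpTo-cong (f≗g ∘ suc) n)

-- A substitution and a sign in each row come out of the multilinear extension together. It serves
-- for the shift from edge entries to coordinates with the inversion signs, and for the passage from
-- vertices to coordinates with the signs of reversed edges.
ev-rows : (h : Fin n → A → B) (ε : Fin n → ℤ) (φ : Fin n → Comb A) (ψ : Fin n → Comb B) →
          (∀ j f → apply (φ j) (f ∘ h j) ≡ ε j * apply (ψ j) f) → (F : Vec B n → ℤ) →
          ev (λ xs → F (tabulate (λ j → h j (lookup xs j)))) (tabulate φ)
            ≡ Πℤ (map ε (allFin n)) * ev F (tabulate ψ)
ev-rows {n = zero}  h ε φ ψ eq F = sym (ℤ.*-identityˡ (F []))
ev-rows {n = suc n} h ε φ ψ eq F = begin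
  apply (φ Fin.zero) (λ a → ev (λ xs → F (h Fin.zero a ∷ tabulate (λ j → h (Fin.suc j) (lookup xs j))))
    (tabulate (φ ∘ Fin.suc)))
    ≡⟨ apply-cong (φ Fin.zero) (λ a → ev-rows (h ∘ Fin.suc) (ε ∘ Fin.suc) (φ ∘ Fin.suc)
         (ψ ∘ Fin.suc) (eq ∘ Fin.suc) (F ∘ (h Fin.zero a ∷_))) ⟩
  apply (φ Fin.zero) (λ a → p * ev (F ∘ (h Fin.zero a ∷_)) (tabulate (ψ ∘ Fin.suc)))
    ≡⟨ apply-scaleˡ (φ Fin.zero) p _ ⟩
  p * apply (φ Fin.zero) (λ a → ev (F ∘ (h Fin.zero a ∷_)) (tabulate (ψ ∘ Fin.suc)))
    ≡⟨ cong (p *_) (eq Fin.zero (λ b → ev (F ∘ (b ∷_)) (tabulate (ψ ∘ Fin.suc)))) ⟩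
  p * (ε Fin.zero * ev F (tabulate ψ))
    ≡⟨ ring p (ε Fin.zero) (ev F (tabulate ψ)) ⟩
  ε Fin.zero * p * ev F (tabulate ψ)
    ≡⟨ cong (_* ev F (tabulate ψ)) (Π-allFin-suc ε) ⟨
  Πℤ (map ε (allFin (suc n))) * ev F (tabulate ψ) ∎
  where
  p = Πℤ (map (ε ∘ Fin.suc) (allFin n))
  ring : ∀ p e v → p * (e * v) ≡ e * p * v
  ring = solve-∀

-- Trees

∨-introˡ : ∀ a b → a ≡ true → a ∨ b ≡ true
∨-introˡ a b eq = cong (_∨ b) eq

∨-introʳ : ∀ a b → b ≡ true → a ∨ b ≡ true
∨-introʳ a b eq = trans (cong (a ∨_) eq) (Bool.∨-zeroʳ a)

any-intro : (p : A → Bool) {l : List A} {a : A} → a ∈ l → p a ≡ true → foldr _∨_ false (map p l) ≡ true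
any-intro p {b ∷ l} (here refl) pa = ∨-introˡ (p b) (foldr _∨_ false (map p l)) pa
any-intro p {b ∷ l} (there a∈l) pa = ∨-introʳ (p b) _ (any-intro p a∈l pa)

any-elim : (p : A → Bool) (l : List A) → foldr _∨_ false (map p l) ≡ true → ∃ λ a → p a ≡ true
any-elim p (a ∷ l) eq with p a in pa
... | true  = a , pa
... | false = any-elim p l eq

∨-elim : ∀ a b → a ∨ b ≡ true → a ≡ true ⊎ b ≡ true
∨-elim true  b eq = inj₁ refl
∨-elim false b eq = inj₂ eq

∧-elim : ∀ a b → a ∧ b ≡ true → a ≡ true × b ≡ true
∧-elim true true eq = refl , refl

⌊⌋-intro : {P : Set} (P? : Dec P) → P → ⌊ P? ⌋ ≡ true
⌊⌋-intro P? p = trans (isYes≗does P?) (dec-true P? p)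

⌊⌋-elim : {P : Set} (P? : Dec P) → ⌊ P? ⌋ ≡ true → P
⌊⌋-elim (yes p) eq = p

Σ-mono-≤ : {f g : A → ℕ} → (∀ a → f a ℕ.≤ g a) → ∀ l → Σℕ (map f l) ℕ.≤ Σℕ (map g l)
Σ-mono-≤ f≤g []      = z≤n
Σ-mono-≤ f≤g (a ∷ l) = ℕ.+-mono-≤ (f≤g a) (Σ-mono-≤ f≤g l)

Σ-mono-< : {f g : A → ℕ} → (∀ a → f a ℕ.≤ g a) → ∀ {l a} → a ∈ l → f a ℕ.< g a →
           Σℕ (map f l) ℕ.< Σℕ (map g l)
Σ-mono-< f≤g {b ∷ l} (here refl) fa<ga = ℕ.+-mono-<-≤ fa<ga (Σ-mono-≤ f≤g l)
Σ-mono-< f≤g {b ∷ l} (there a∈l) fa<ga = ℕ.+-mono-≤-< (f≤g b) (Σ-mono-< f≤g a∈l fa<ga)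

countFin-mono-< : (p q : Fin n → Bool) → (∀ i → p i ≡ true → q i ≡ true) →
                  ∀ i → p i ≡ false → q i ≡ true → countFin p ℕ.< countFin q
countFin-mono-< p q p⇒q i pi qi = Σ-mono-< weak (∈-allFin i)
  (subst₂ (λ a b → (if a then 1 else 0) ℕ.< (if b then 1 else 0)) (sym pi) (sym qi) (s≤s z≤n))
  where
  weak : ∀ j → (if p j then 1 else 0) ℕ.≤ (if q j then 1 else 0)
  weak j with p j in pj
  ... | false = z≤n
  ... | true  = subst (λ b → 1 ℕ.≤ (if b then 1 else 0)) (sym (p⇒q j pj)) ℕ.≤-refl

countFin-true : ∀ n → countFin {n} (λ _ → true) ≡ n
countFin-true zero    = refl
countFin-true (suc n) = cong suc
  (trans (cong Σℕ (trans (List.map-tabulate {n = n} Fin.suc (λ _ → 1)) (sym (List.map-tabulate {n = n} id (λ _ → 1)))))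
         (countFin-true n))

countFin-full : (p : Fin n → Bool) → n ℕ.≤ countFin p → ∀ i → p i ≡ true
countFin-full {n} p n≤ i with p i in pi
... | true  = refl
... | false = contradiction
  (ℕ.<-≤-trans (countFin-mono-< p (λ _ → true) (λ _ _ → refl) i pi refl) (ℕ.≤-reflexive (countFin-true n)))
  (ℕ.≤⇒≯ n≤)

injective⇒surjective : (f : Fin n → Fin n) → (∀ {i j} → f i ≡ f j → i ≡ j) → ∀ y → ∃ λ x → f x ≡ y
injective⇒surjective {suc n} f inj y with Fin.any? (λ x → f x Fin.≟ y)
... | yes found = found
... | no missing = contradiction
  (Fin.injective⇒≤ {f = λ x → Fin.punchOut (missing′ x)}
    (λ eq → inj (Fin.punchOut-injective (missing′ _) (missing′ _) eq)))
  ℕ.1+n≰n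
  where
  missing′ : ∀ x → y ≢ f x
  missing′ x eq = missing (x , sym eq)

map-allFin-↭ : (f g : Fin n → Fin n) → (∀ i → g (f i) ≡ i) → (∀ i → f (g i) ≡ i) →
               map f (allFin n) ↭ allFin n
map-allFin-↭ {n} f g g∘f f∘g = ∼bag⇒↭ (unique∧set⇒bag
  (map⁺ (λ {i} {j} eq → trans (sym (g∘f i)) (trans (cong g eq) (g∘f j))) (allFin⁺ n))
  (allFin⁺ n)
  (λ {i} → mk⇔ (λ _ → ∈-allFin i) (λ _ → subst (_∈ map f (allFin n)) (f∘g i) (∈-map⁺ f (∈-allFin (g i))))))

-- Distance from the root and the standard orientation

module _ (T : Tree m) where

  data Adjacent (j : Fin m) : Fin (suc m) → Fin (suc m) → Set where
    tail-head : Adjacent j (tail T j) (head T j)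
    head-tail : Adjacent j (head T j) (tail T j)

  reach-mono : ∀ s v → reach T s v ≡ true → reach T (suc s) v ≡ true
  reach-mono s v = ∨-introˡ (reach T s v) _

  reach-mono-≤ : ∀ {s t} v → s ℕ.≤ t → reach T s v ≡ true → reach T t v ≡ true
  reach-mono-≤ {s} v s≤t eq = go (ℕ.≤⇒≤′ s≤t)
    where
    go : ∀ {t} → s ℕ.≤′ t → reach T t v ≡ true
    go (ℕ.≤′-reflexive refl) = eq
    go {suc t} (ℕ.≤′-step s≤t) = reach-mono t v (go s≤t)

  reach-step : ∀ s j {u v} → Adjacent j u v → reach T s u ≡ true → reach T (suc s) v ≡ true
  reach-step s j {u} {v} adj eq = ∨-introʳ (reach T s v) _ (any-intro _ (∈-allFin j) (via adj eq))
    where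
    via : ∀ {u v} → Adjacent j u v → reach T s u ≡ true →
          (⌊ v Fin.≟ head T j ⌋ ∧ reach T s (tail T j)) ∨ (⌊ v Fin.≟ tail T j ⌋ ∧ reach T s (head T j)) ≡ true
    via tail-head eq = ∨-introˡ _ _ (cong₂ _∧_ (⌊⌋-intro (head T j Fin.≟ head T j) refl) eq)
    via head-tail eq = ∨-introʳ (⌊ tail T j Fin.≟ head T j ⌋ ∧ _) _
      (cong₂ _∧_ (⌊⌋-intro (tail T j Fin.≟ tail T j) refl) eq)

  reach-inv : ∀ s v → reach T (suc s) v ≡ true → reach T s v ≡ false →
              ∃ λ j → ∃ λ u → Adjacent j u v × reach T s u ≡ true
  reach-inv s v eq new with ∨-elim (reach T s v) _ eq
  ... | inj₁ old = contradiction (trans (sym old) new) λ ()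
  ... | inj₂ via with any-elim _ (allFin m) via
  ...   | j , at with ∨-elim (⌊ v Fin.≟ head T j ⌋ ∧ reach T s (tail T j)) _ at
  ...     | inj₁ eq′ with refl ← ⌊⌋-elim (v Fin.≟ head T j) (proj₁ (∧-elim _ (reach T s (tail T j)) eq′))
    = j , tail T j , tail-head , proj₂ (∧-elim ⌊ v Fin.≟ head T j ⌋ _ eq′)
  ...     | inj₂ eq′ with refl ← ⌊⌋-elim (v Fin.≟ tail T j) (proj₁ (∧-elim _ (reach T s (head T j)) eq′))
    = j , head T j , head-tail , proj₂ (∧-elim ⌊ v Fin.≟ tail T j ⌋ _ eq′)

  reach-root : ∀ s → reach T s Fin.zero ≡ true
  reach-root zero    = refl
  reach-root (suc s) = reach-mono s Fin.zero (reach-root s)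

  closed⇒reach-all : ∀ s → (∀ v → reach T (suc s) v ≡ true → reach T s v ≡ true) →
                     ∀ v → reach T s v ≡ true
  closed⇒reach-all s closed v = along (connected T Fin.zero v)
    where
    along : ∀ {v} → Connected (tail T) (head T) Fin.zero v → reach T s v ≡ true
    along here      = reach-root s
    along (fwd j c) = closed _ (reach-step s j tail-head (along c))
    along (bwd j c) = closed _ (reach-step s j head-tail (along c))

  -- As long as the reached set is not closed under adjacency, each stage adds a vertex; once it is
  -- closed, connectedness makes it everything. At stage m the second alternative also means all m +
  -- 1 vertices.
  reach-count : ∀ s → (∀ v → reach T s v ≡ true) ⊎ s ℕ.< countFin (reach T s)
  reach-count zero = inj₂ (s≤s z≤n)
  reach-count (suc s) with reach-count s
  ... | inj₁ all = inj₁ (λ v → reach-mono s v (all v))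
  ... | inj₂ s< with Fin.any? (λ v → (reach T (suc s) v Bool.≟ true) ×-dec (reach T s v Bool.≟ false))
  ...   | yes (v , new , old) = inj₂ (ℕ.≤-<-trans s< (countFin-mono-< _ _ (reach-mono s) v old new))
  ...   | no none = inj₁ (λ v → reach-mono s v
            (closed⇒reach-all s (λ u new → Bool.¬-not (λ old → none (u , new , old))) v))

  reach-all : ∀ v → reach T m v ≡ true
  reach-all with reach-count m
  ... | inj₁ all = all
  ... | inj₂ m<  = countFin-full (reach T m) m<

  first-reach : ∀ s v → v ≢ Fin.zero → reach T s v ≡ true →
                ∃ λ t → t ℕ.< s × reach T (suc t) v ≡ true × reach T t v ≡ false
  first-reach zero v v≢0 eq = contradiction (⌊⌋-elim (v Fin.≟ Fin.zero) eq) v≢0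
  first-reach (suc s) v v≢0 eq with reach T s v Bool.≟ true
  ... | no new = s , ℕ.≤-refl , eq , Bool.¬-not new
  ... | yes old with t , t<s , rest ← first-reach s v v≢0 old = t , ℕ.m<n⇒m<1+n t<s , rest

  -- The neighbour is the one from which v is first reached. `dist` counts the stages at which a
  -- vertex is still unreached: stage t separates u from v, and at no stage is v reached but u not.
  closer-neighbour : ∀ v → v ≢ Fin.zero → ∃ λ j → ∃ λ u → Adjacent j u v × dist T u ℕ.< dist T v
  closer-neighbour v v≢0
    with t , t<m , now , before ← first-reach m v v≢0 (reach-all v)
    with j , u , adj , reached ← reach-inv t v now before
    = j , u , adj , Σ-mono-< weak (∈-upTo⁺ (ℕ.m<n⇒m<1+n t<m))
        (subst₂ (λ a b → (if a then 0 else 1) ℕ.< (if b then 0 else 1)) (sym reached) (sym before) (s≤s z≤n))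
    where
    weak : ∀ s → (if reach T s u then 0 else 1) ℕ.≤ (if reach T s v then 0 else 1)
    weak s with reach T s v in eq
    ... | true  = subst (λ b → (if b then 0 else 1) ℕ.≤ 0) (sym (reach-mono-≤ u t≤s reached)) z≤n
      where
      t≤s : t ℕ.≤ s
      t≤s = ℕ.≮⇒≥ (λ s<t → contradiction
        (trans (sym (reach-mono-≤ v (ℕ.<⇒≤ s<t) eq)) before) λ ())
    ... | false with reach T s u
    ...   | true  = z≤n
    ...   | false = ℕ.≤-refl

  stdTail : Fin m → Fin (suc m)
  stdTail j = if dist T (tail T j) ℕ.<ᵇ dist T (head T j) then tail T j else head T j

  std-endpoints : ∀ {j u v} → Adjacent j u v → dist T u ℕ.< dist T v → stdHead T j ≡ v × stdTail j ≡ u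
  std-endpoints {j} tail-head lt =
    cong (λ b → if b then head T j else tail T j) eq , cong (λ b → if b then tail T j else head T j) eq
    where
    eq : (dist T (tail T j) ℕ.<ᵇ dist T (head T j)) ≡ true
    eq = Equivalence.to Bool.T-≡ (ℕ.<⇒<ᵇ lt)
  std-endpoints {j} head-tail lt =
    cong (λ b → if b then head T j else tail T j) eq , cong (λ b → if b then tail T j else head T j) eq
    where
    eq : (dist T (tail T j) ℕ.<ᵇ dist T (head T j)) ≡ false
    eq = Bool.¬-not (λ eq′ → ℕ.<-asym lt (ℕ.<ᵇ⇒< _ _ (Equivalence.from Bool.T-≡ eq′)))

  -- The inequality is recorded because `stdHead` alone does not give it: a tie of distances would
  -- select the tail. Ties are excluded only afterwards, by counting.
  data Enters : Fin (suc m) → Fin (suc m) → Set where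
    root : Enters Fin.zero Fin.zero
    edge : ∀ {j v} → stdHead T j ≡ v → dist T (stdTail j) ℕ.< dist T v → Enters (Fin.suc j) v

  enters : ∀ v → ∃ λ i → Enters i v
  enters Fin.zero = Fin.zero , root
  enters v@(Fin.suc _)
    with j , u , adj , lt ← closer-neighbour v (λ ())
    with h , t ← std-endpoints adj lt
    = Fin.suc j , edge h (subst (λ w → dist T w ℕ.< dist T v) (sym t) lt)

  π-Enters : ∀ {i v} → Enters i v → π T i ≡ v
  π-Enters root       = refl
  π-Enters (edge h _) = h

  π⁻¹ : Fin (suc m) → Fin (suc m)
  π⁻¹ v = proj₁ (enters v)

  π-π⁻¹ : ∀ v → π T (π⁻¹ v) ≡ v
  π-π⁻¹ v = π-Enters (proj₂ (enters v))

  -- There are as many indices, one for the root and one for each of the m edges, as vertices. Hence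
  -- choosing an entering edge for every vertex uses all edges, and `π` is a permutation.
  π⁻¹-surjective : ∀ i → ∃ λ v → π⁻¹ v ≡ i
  π⁻¹-surjective = injective⇒surjective π⁻¹
    (λ {u} {v} eq → trans (sym (π-π⁻¹ u)) (trans (cong (π T) eq) (π-π⁻¹ v)))

  π⁻¹-π : ∀ i → π⁻¹ (π T i) ≡ i
  π⁻¹-π i with v , refl ← π⁻¹-surjective i = cong π⁻¹ (π-π⁻¹ v)

  -- Every edge is the chosen entering edge of some vertex and so inherits the inequality stored in
  -- `Enters`.
  dist-stdTail<dist-stdHead : ∀ j → dist T (stdTail j) ℕ.< dist T (stdHead T j)
  dist-stdTail<dist-stdHead j
    with v , eq ← π⁻¹-surjective (Fin.suc j)
    with edge refl lt ← subst (λ i → Enters i v) eq (proj₂ (enters v))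
    = lt

  stdHead≢stdTail : ∀ j → stdHead T j ≢ stdTail j
  stdHead≢stdTail j eq = ℕ.<-irrefl (cong (dist T) (sym eq)) (dist-stdTail<dist-stdHead j)

  -- Were edge j to choose its lower end u, the edge entering u would have to do the same, and so
  -- on down to the root, which is not available.
  distinct-ends⇒stdHead : (c : Fin m → Fin (suc m)) → (∀ j → c j ≡ stdHead T j ⊎ c j ≡ stdTail j) →
                          (∀ j → c j ≢ Fin.zero) → (∀ {i j} → c i ≡ c j → i ≡ j) →
                          ∀ j → c j ≡ stdHead T j
  distinct-ends⇒stdHead c choice c≢0 c-injective j with choice j
  ... | inj₁ up   = up
  ... | inj₂ down = contradiction (<-wellFounded _) (never j down)
    where
    never : ∀ j → c j ≡ stdTail j → ¬ Acc ℕ._<_ (dist T (stdTail j))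
    never j down (acc rec) = descend (proj₂ (enters (stdTail j))) refl
      where
      descend : ∀ {i v} → Enters i v → v ≡ stdTail j → ⊥
      descend root eq = c≢0 j (trans down (sym eq))
      descend (edge {j′} h lt) refl with choice j′
      ... | inj₂ down′ = never j′ down′ (rec lt)
      ... | inj₁ up with refl ← c-injective (trans up (trans h (sym down))) = stdHead≢stdTail j h

-- Signs and products over pairs

pairProd-cong : {e f : A → A → ℤ} → (∀ a b → e a b ≡ f a b) → ∀ l → pairProd e l ≡ pairProd f l
pairProd-cong e≗f []      = refl
pairProd-cong e≗f (a ∷ l) = cong₂ _*_ (cong Πℤ (List.map-cong (e≗f a) l)) (pairProd-cong e≗f l)

pairProd-map : (e : B → B → ℤ) (f : A → B) (l : List A) →
               pairProd e (map f l) ≡ pairProd (λ a b → e (f a) (f b)) l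
pairProd-map e f []      = refl
pairProd-map e f (a ∷ l) = cong₂ _*_ (cong Πℤ (sym (List.map-∘ l))) (pairProd-map e f l)

Π-* : (f g : A → ℤ) (l : List A) → Πℤ (map (λ a → f a * g a) l) ≡ Πℤ (map f l) * Πℤ (map g l)
Π-* f g []      = refl
Π-* f g (a ∷ l) = trans (cong (f a * g a *_) (Π-* f g l)) (ring (f a) (g a) (Πℤ (map f l)) (Πℤ (map g l)))
  where
  ring : ∀ a b u v → a * b * (u * v) ≡ a * u * (b * v)
  ring = solve-∀

pairProd-* : (e f : A → A → ℤ) (l : List A) →
             pairProd (λ a b → e a b * f a b) l ≡ pairProd e l * pairProd f l
pairProd-* e f []      = refl
pairProd-* e f (a ∷ l) = trans (cong₂ _*_ (Π-* (e a) (f a) l) (pairProd-* e f l))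
  (ring (Πℤ (map (e a) l)) (Πℤ (map (f a) l)) (pairProd e l) (pairProd f l))
  where
  ring : ∀ a b u v → a * b * (u * v) ≡ a * u * (b * v)
  ring = solve-∀

Π-↭ : (f : A → ℤ) {l l′ : List A} → l ↭ l′ → Πℤ (map f l) ≡ Πℤ (map f l′)
Π-↭ f Perm.refl          = refl
Π-↭ f (Perm.prep a p)    = cong (f a *_) (Π-↭ f p)
Π-↭ f (Perm.swap a b p)  = trans (cong (λ z → f a * (f b * z)) (Π-↭ f p)) (ring (f a) (f b) _)
  where
  ring : ∀ a b u → a * (b * u) ≡ b * (a * u)
  ring = solve-∀
Π-↭ f (Perm.trans p q)   = trans (Π-↭ f p) (Π-↭ f q)

pairProd-↭ : (e : A → A → ℤ) → (∀ a b → e a b ≡ e b a) → {l l′ : List A} → l ↭ l′ →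
             pairProd e l ≡ pairProd e l′
pairProd-↭ e e-sym Perm.refl         = refl
pairProd-↭ e e-sym (Perm.prep a p)   = cong₂ _*_ (Π-↭ (e a) p) (pairProd-↭ e e-sym p)
pairProd-↭ e e-sym {l = a ∷ b ∷ l} {l′ = b ∷ a ∷ l′} (Perm.swap a b p) = begin
  e a b * Πℤ (map (e a) l) * (Πℤ (map (e b) l) * pairProd e l)
    ≡⟨ ring (e a b) (Πℤ (map (e a) l)) (Πℤ (map (e b) l)) (pairProd e l) ⟩
  e a b * Πℤ (map (e b) l) * (Πℤ (map (e a) l) * pairProd e l)
    ≡⟨ cong₂ _*_ (cong₂ _*_ (e-sym a b) (Π-↭ (e b) p)) (cong₂ _*_ (Π-↭ (e a) p) (pairProd-↭ e e-sym p)) ⟩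
  e b a * Πℤ (map (e b) l′) * (Πℤ (map (e a) l′) * pairProd e l′) ∎
  where
  ring : ∀ p a b u → p * a * (b * u) ≡ p * b * (a * u)
  ring = solve-∀
pairProd-↭ e e-sym (Perm.trans p q)  = trans (pairProd-↭ e e-sym p) (pairProd-↭ e e-sym q)

map-allFin-cong : {A : Set} {f g : Fin n → A} → (∀ i → f i ≡ g i) → map f (allFin n) ≡ map g (allFin n)
map-allFin-cong f≗g = List.map-cong f≗g _

pairProd-allFin-suc : (e : Fin (suc n) → Fin (suc n) → ℤ) →
  pairProd e (allFin (suc n))
    ≡ Πℤ (map (e Fin.zero ∘ Fin.suc) (allFin n)) * pairProd (λ i j → e (Fin.suc i) (Fin.suc j)) (allFin n)
pairProd-allFin-suc {n} e = begin
  Πℤ (map (e Fin.zero) (List.tabulate Fin.suc)) * pairProd e (List.tabulate Fin.suc)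
    ≡⟨ cong (λ l → Πℤ (map (e Fin.zero) l) * pairProd e l) (List.map-tabulate id Fin.suc) ⟨
  Πℤ (map (e Fin.zero) (map Fin.suc (allFin n))) * pairProd e (map Fin.suc (allFin n))
    ≡⟨ cong₂ _*_ (cong Πℤ (sym (List.map-∘ (allFin n)))) (pairProd-map e Fin.suc (allFin n)) ⟩
  Πℤ (map (e Fin.zero ∘ Fin.suc) (allFin n)) * pairProd (λ i j → e (Fin.suc i) (Fin.suc j)) (allFin n) ∎

-- This links the recursive pair product to the index conditions used in `pairsLt` and
-- `πInversions`.
pairProd-double : (e : Fin n → Fin n → ℤ) →
  pairProd e (allFin n)
    ≡ Πℤ (map (λ i → Πℤ (map (λ j → if toℕ i ℕ.<ᵇ toℕ j then e i j else + 1) (allFin n))) (allFin n))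
pairProd-double {zero}  e = refl
pairProd-double {suc n} e = begin
  pairProd e (allFin (suc n))
    ≡⟨ pairProd-allFin-suc e ⟩
  Πℤ (map (e Fin.zero ∘ Fin.suc) (allFin n)) * pairProd (λ i j → e (Fin.suc i) (Fin.suc j)) (allFin n)
    ≡⟨ cong₂ _*_ (sym (ℤ.*-identityˡ (Πℤ (map (e Fin.zero ∘ Fin.suc) (allFin n))))) (pairProd-double (λ i j → e (Fin.suc i) (Fin.suc j))) ⟩
  + 1 * Πℤ (map (e Fin.zero ∘ Fin.suc) (allFin n)) *
    Πℤ (map (λ i → Πℤ (map (λ j → entry (Fin.suc i) (Fin.suc j)) (allFin n))) (allFin n))
    ≡⟨ cong₂ _*_ (Π-allFin-suc (entry Fin.zero)) (cong Πℤ (map-allFin-cong λ i →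
         trans (Π-allFin-suc (entry (Fin.suc i))) (ℤ.*-identityˡ _))) ⟨
  Πℤ (map (entry Fin.zero) (allFin (suc n))) *
    Πℤ (map (λ i → Πℤ (map (entry (Fin.suc i)) (allFin (suc n)))) (allFin n))
    ≡⟨ Π-allFin-suc (λ i → Πℤ (map (entry i) (allFin (suc n)))) ⟨
  Πℤ (map (λ i → Πℤ (map (entry i) (allFin (suc n)))) (allFin (suc n))) ∎
  where
  entry : Fin (suc n) → Fin (suc n) → ℤ
  entry i j = if toℕ i ℕ.<ᵇ toℕ j then e i j else + 1

negOnePow-+ : ∀ a b → negOnePow (a ℕ.+ b) ≡ negOnePow a * negOnePow b
negOnePow-+ zero    b = sym (ℤ.*-identityˡ _)
negOnePow-+ (suc a) b = trans (cong -_ (negOnePow-+ a b)) (ℤ.neg-distribˡ-* (negOnePow a) (negOnePow b))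

negOnePow-Σ : (f : A → ℕ) (l : List A) → negOnePow (Σℕ (map f l)) ≡ Πℤ (map (negOnePow ∘ f) l)
negOnePow-Σ f []      = refl
negOnePow-Σ f (a ∷ l) = trans (negOnePow-+ (f a) _) (cong (negOnePow (f a) *_) (negOnePow-Σ f l))

negOnePow-countFin : (p : Fin n → Bool) →
  negOnePow (countFin p) ≡ Πℤ (map (λ i → if p i then - + 1 else + 1) (allFin n))
negOnePow-countFin p = trans
  (negOnePow-Σ (λ i → if p i then 1 else 0) (allFin _))
  (cong Πℤ (map-allFin-cong λ i → Bool.if-float negOnePow (p i) {x = 1} {y = 0}))

Π-filterᵇ : (p : A → Bool) (f : A → ℤ) (l : List A) →
            Πℤ (map f (filterᵇ p l)) ≡ Πℤ (map (λ a → if p a then f a else + 1) l)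
Π-filterᵇ p f [] = refl
Π-filterᵇ p f (a ∷ l) with p a
... | true  = cong (f a *_) (Π-filterᵇ p f l)
... | false = trans (Π-filterᵇ p f l) (sym (ℤ.*-identityˡ _))

Π-pairsLt : (f : Fin n × Fin n → ℤ) → Πℤ (map f (pairsLt n)) ≡ pairProd (λ i j → f (i , j)) (allFin n)
Π-pairsLt {n} f = begin
  Πℤ (map f (pairsLt n))
    ≡⟨ Π-concatMap f _ (allFin n) ⟩
  Πℤ (map (λ i → Πℤ (map f (map (i ,_) (filterᵇ (λ j → toℕ i ℕ.<ᵇ toℕ j) (allFin n))))) (allFin n))
    ≡⟨ cong Πℤ (map-allFin-cong λ i → trans (cong Πℤ (sym (List.map-∘ (filterᵇ (λ j → toℕ i ℕ.<ᵇ toℕ j) (allFin n)))))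
         (Π-filterᵇ (λ j → toℕ i ℕ.<ᵇ toℕ j) (λ j → f (i , j)) (allFin n))) ⟩
  Πℤ (map (λ i → Πℤ (map (λ j → if toℕ i ℕ.<ᵇ toℕ j then f (i , j) else + 1) (allFin n))) (allFin n))
    ≡⟨ pairProd-double (λ i j → f (i , j)) ⟨
  pairProd (λ i j → f (i , j)) (allFin n) ∎

-- The products of the statement as Vandermonde products

toList-tabulate : (f : Fin n → A) → toList (tabulate f) ≡ map f (allFin n)
toList-tabulate {zero}  f = refl
toList-tabulate {suc n} f = cong (f Fin.zero ∷_) (trans (toList-tabulate (f ∘ Fin.suc))
  (trans (List.map-tabulate id (f ∘ Fin.suc)) (sym (List.map-tabulate Fin.suc f))))

V-tabulate : (x : Fin n → ℤ) → V (tabulate x) ≡ pairProd (λ i j → x j - x i) (allFin n)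
V-tabulate x = trans (cong (pairProd _) (toList-tabulate x)) (pairProd-map _ x (allFin _))

shifted : Vec ℤ n → Vec ℤ n
shifted l = tabulate (λ j → lookup l j + + suc (toℕ j))

numProd-V : (k : Vec ℤ n) → numProd k ≡ V (shifted k)
numProd-V {n} k = begin
  numProd k
    ≡⟨ Π-pairsLt {n} _ ⟩
  pairProd (λ i j → lookup k j - lookup k i + (+ toℕ j - + toℕ i)) (allFin n)
    ≡⟨ pairProd-cong (λ i j → ring (lookup k j) (lookup k i) (+ toℕ j) (+ toℕ i)) (allFin n) ⟩
  pairProd (λ i j → lookup k j + + suc (toℕ j) - (lookup k i + + suc (toℕ i))) (allFin n)
    ≡⟨ V-tabulate (λ i → lookup k i + + suc (toℕ i)) ⟨
  V (shifted k) ∎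
  where
  ring : ∀ a b i j → a - b + (i - j) ≡ a + (+ 1 + i) - (b + (+ 1 + j))
  ring = solve-∀

Π-allFin-last : (f : ℕ → ℤ) (n : ℕ) →
  Πℤ (map (f ∘ toℕ) (allFin (suc n))) ≡ Πℤ (map (f ∘ toℕ) (allFin n)) * f n
Π-allFin-last f zero = ℤ.*-comm (f 0) (+ 1)
Π-allFin-last f (suc n) = begin
  Πℤ (map (f ∘ toℕ) (allFin (suc (suc n))))
    ≡⟨ Π-allFin-suc {n = suc n} (f ∘ toℕ) ⟩
  f 0 * Πℤ (map (f ∘ suc ∘ toℕ) (allFin (suc n)))
    ≡⟨ cong (f 0 *_) (Π-allFin-last (f ∘ suc) n) ⟩
  f 0 * (Πℤ (map (f ∘ suc ∘ toℕ) (allFin n)) * f (suc n))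
    ≡⟨ ℤ.*-assoc (f 0) _ (f (suc n)) ⟨
  f 0 * Πℤ (map (f ∘ suc ∘ toℕ) (allFin n)) * f (suc n)
    ≡⟨ cong (_* f (suc n)) (Π-allFin-suc {n = n} (f ∘ toℕ)) ⟨
  Πℤ (map (f ∘ toℕ) (allFin (suc n))) * f (suc n) ∎

Π-factorial : ∀ n → Πℤ (map (λ j → + suc (toℕ j)) (allFin n)) ≡ factorial n
Π-factorial zero    = refl
Π-factorial (suc n) = trans (Π-allFin-last (λ i → + suc i) n)
  (trans (cong (_* + suc n) (Π-factorial n)) (ℤ.*-comm (factorial n) (+ suc n)))

-- The pairs containing the smallest index contribute 1, 2, ..., n. This is the factorial that
-- integration over the n edges of a tree produces.
denProd-suc : ∀ n → denProd (suc n) ≡ factorial n * denProd n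
denProd-suc n = begin
  denProd (suc n)
    ≡⟨ Π-pairsLt {suc n} _ ⟩
  pairProd (λ i j → + toℕ j - + toℕ i) (allFin (suc n))
    ≡⟨ pairProd-allFin-suc {n} (λ i j → + toℕ j - + toℕ i) ⟩
  Πℤ (map (λ j → + suc (toℕ j) - + 0) (allFin n))
    * pairProd (λ i j → + suc (toℕ j) - + suc (toℕ i)) (allFin n)
    ≡⟨ cong₂ _*_
         (trans (cong Πℤ (map-allFin-cong {n} λ j → ℤ.+-identityʳ (+ suc (toℕ j)))) (Π-factorial n))
         (pairProd-cong (λ i j → ring (+ toℕ j) (+ toℕ i)) (allFin n)) ⟩
  factorial n * pairProd (λ i j → + toℕ j - + toℕ i) (allFin n)
    ≡⟨ cong (factorial n *_) (Π-pairsLt {n} _) ⟨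
  factorial n * denProd n ∎
  where
  ring : ∀ i j → (+ 1 + i) - (+ 1 + j) ≡ i - j
  ring = solve-∀

-- Permuting the arguments of the Vandermonde product

module _ (x : Fin n → ℤ) where

  private
    lt : Fin n → Fin n → Bool
    lt a b = toℕ a ℕ.<ᵇ toℕ b

    -- `ordered` always subtracts the value of smaller index, which makes it symmetric and its pair
    -- product invariant under permutations; `orientation` keeps the sign, so its pair product
    -- counts inversions.
    orientation ordered : Fin n → Fin n → ℤ
    orientation a b = if lt b a then - + 1 else + 1
    ordered a b = if lt b a then x a - x b else x b - x a

    lt-true : ∀ {a b} → toℕ a ℕ.< toℕ b → lt a b ≡ true
    lt-true a<b = Equivalence.to Bool.T-≡ (ℕ.<⇒<ᵇ a<b)

    lt-false : ∀ {a b} → toℕ a ℕ.< toℕ b → lt b a ≡ false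
    lt-false a<b = Bool.¬-not (λ b<a → ℕ.<-asym a<b (ℕ.<ᵇ⇒< _ _ (Equivalence.from Bool.T-≡ b<a)))

    ordered-sym : ∀ a b → ordered a b ≡ ordered b a
    ordered-sym a b with Fin.<-cmp a b
    ... | tri< a<b _ _  rewrite lt-true a<b | lt-false a<b = refl
    ... | tri≈ _ refl _ = refl
    ... | tri> _ _ b<a  rewrite lt-true b<a | lt-false b<a = refl

    ordered-allFin : pairProd ordered (allFin n) ≡ pairProd (λ a b → x b - x a) (allFin n)
    ordered-allFin = begin
      pairProd ordered (allFin n)
        ≡⟨ pairProd-double ordered ⟩
      Πℤ (map (λ a → Πℤ (map (λ b → if lt a b then ordered a b else + 1) (allFin n))) (allFin n))
        ≡⟨ cong Πℤ (map-allFin-cong λ a → cong Πℤ (map-allFin-cong λ b → same a b)) ⟩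
      Πℤ (map (λ a → Πℤ (map (λ b → if lt a b then x b - x a else + 1) (allFin n))) (allFin n))
        ≡⟨ pairProd-double (λ a b → x b - x a) ⟨
      pairProd (λ a b → x b - x a) (allFin n) ∎
      where
      same : ∀ a b → (if lt a b then ordered a b else + 1) ≡ (if lt a b then x b - x a else + 1)
      same a b with lt a b in eq
      ... | false = refl
      ... | true  = cong (λ c → if c then x a - x b else x b - x a)
        (lt-false {a} {b} (ℕ.<ᵇ⇒< _ _ (Equivalence.from Bool.T-≡ eq)))

    oriented : ∀ a b → x b - x a ≡ orientation a b * ordered a b
    oriented a b with lt b a
    ... | true  = ring (x a) (x b)
      where
      ring : ∀ u v → v - u ≡ - + 1 * (u - v)
      ring = solve-∀
    ... | false = sym (ℤ.*-identityˡ _)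

  V-permute : (p : Fin n → Fin n) → map p (allFin n) ↭ allFin n →
              V (tabulate (x ∘ p))
                ≡ pairProd (λ i j → if toℕ (p j) ℕ.<ᵇ toℕ (p i) then - + 1 else + 1) (allFin n)
                  * V (tabulate x)
  V-permute p p-↭ = begin
    V (tabulate (x ∘ p))
      ≡⟨ V-tabulate (x ∘ p) ⟩
    pairProd (λ i j → x (p j) - x (p i)) (allFin n)
      ≡⟨ pairProd-map (λ a b → x b - x a) p (allFin n) ⟨
    pairProd (λ a b → x b - x a) (map p (allFin n))
      ≡⟨ pairProd-cong oriented (map p (allFin n)) ⟩
    pairProd (λ a b → orientation a b * ordered a b) (map p (allFin n))
      ≡⟨ pairProd-* orientation ordered (map p (allFin n)) ⟩
    pairProd orientation (map p (allFin n)) * pairProd ordered (map p (allFin n))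
      ≡⟨ cong₂ _*_ (pairProd-map orientation p (allFin n))
           (trans (pairProd-↭ ordered ordered-sym p-↭) (trans ordered-allFin (sym (V-tabulate x)))) ⟩
    pairProd (λ i j → orientation (p i) (p j)) (allFin n) * V (tabulate x) ∎

negOnePow-πInversions : (T : Tree m) →
  negOnePow (πInversions T)
    ≡ pairProd (λ i j → if toℕ (π T j) ℕ.<ᵇ toℕ (π T i) then - + 1 else + 1) (allFin (suc m))
negOnePow-πInversions {m} T = begin
  negOnePow (πInversions T)
    ≡⟨ negOnePow-Σ (λ a → countFin (λ b → (toℕ a ℕ.<ᵇ toℕ b) ∧ inverted a b)) (allFin (suc m)) ⟩
  Πℤ (map (λ a → negOnePow (countFin (λ b → (toℕ a ℕ.<ᵇ toℕ b) ∧ inverted a b))) (allFin (suc m)))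
    ≡⟨ cong Πℤ (map-allFin-cong λ a → trans (negOnePow-countFin (λ b → (toℕ a ℕ.<ᵇ toℕ b) ∧ inverted a b))
         (cong Πℤ (map-allFin-cong λ b → if-∧ (toℕ a ℕ.<ᵇ toℕ b) (inverted a b)))) ⟩
  Πℤ (map (λ a → Πℤ (map (λ b → if toℕ a ℕ.<ᵇ toℕ b then (if inverted a b then - + 1 else + 1) else + 1)
    (allFin (suc m)))) (allFin (suc m)))
    ≡⟨ pairProd-double (λ a b → if inverted a b then - + 1 else + 1) ⟨
  pairProd (λ a b → if inverted a b then - + 1 else + 1) (allFin (suc m)) ∎
  where
  inverted : Fin (suc m) → Fin (suc m) → Bool
  inverted a b = toℕ (π T b) ℕ.<ᵇ toℕ (π T a)
  if-∧ : ∀ p q → (if p ∧ q then - + 1 else + 1) ≡ (if p then (if q then - + 1 else + 1) else + 1)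
  if-∧ true  q = refl
  if-∧ false q = refl

V-π : (T : Tree m) (x : Fin (suc m) → ℤ) →
      V (tabulate (x ∘ π T)) ≡ negOnePow (πInversions T) * V (tabulate x)
V-π T x = trans (V-permute x (π T) (map-allFin-↭ (π T) (π⁻¹ T) (π⁻¹-π T) (π-π⁻¹ T)))
  (cong (_* V (tabulate x)) (sym (negOnePow-πInversions T)))

-- Admissible vectors

-- The list of candidates is computed by a private function of Defs, which can only be denoted by
-- letting unification find it: first at vectors of length m, as in the definition of candidates,
-- then at their tails, where the two indices m and n differ and can be generalised independently.
mutual
  boxesₘ : Tree m → Vec ℤ (suc m) → Vec (ℤ × ℤ) m → List (Vec ℤ m)
  boxesₘ T k bs = _

  boxesₘ-unique : (T : Tree m) (k : Vec ℤ (suc m)) → candidates T k ≡ candidates T k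
  boxesₘ-unique T k with tabulate (λ j → (lowE T k j - + suc (toℕ j)) , (highE T k j - + suc (toℕ j)))
  ... | bs = refl {x = boxesₘ T k bs}

mutual
  boxesₘ₊₁ : Tree (suc m) → Vec ℤ (suc (suc m)) → Vec (ℤ × ℤ) m → List (Vec ℤ m)
  boxesₘ₊₁ T k bs = _

  boxesₘ₊₁-unique : (T : Tree (suc m)) (k : Vec ℤ (suc (suc m))) (bs : Vec (ℤ × ℤ) m) →
                    boxesₘ T k ((+ 0 , + 1) ∷ bs) ≡ map (+ 0 ∷_) (boxesₘ₊₁ T k bs) List.++ []
  -- The range from `+ 0` to `+ 1` has one member, so a single unfolding leaves just the recursive
  -- call to be matched.
  boxesₘ₊₁-unique T k bs = refl

mutual
  boxes : Tree m → Vec ℤ (suc m) → Vec (ℤ × ℤ) n → List (Vec ℤ n)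
  boxes T k bs = _

  boxes-unique : (T : Tree (suc m)) (k : Vec ℤ (suc (suc m))) (bs : Vec (ℤ × ℤ) m) →
                 boxesₘ₊₁ T k bs ≡ boxesₘ₊₁ T k bs
  boxes-unique {m} T k bs with suc m | T | k
  ... | _ | T′ | k′ = refl {x = boxes T′ k′ bs}

module _ (T : Tree m) (k : Vec ℤ (suc m)) where

  -- The range length is cut off at zero when negative; the hypothesis exhibits the difference as a
  -- natural number, so the definition computes.
  boxes-suc : (lo hi : Fin (suc n) → ℤ) (len : ℕ) → hi Fin.zero - lo Fin.zero ≡ + len →
              boxes T k (tabulate (λ j → lo j , hi j))
                ≡ concatMap (λ x → map (x ∷_) (boxes T k (tabulate (λ j → lo (Fin.suc j) , hi (Fin.suc j)))))
                    (interval (lo Fin.zero) len)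
  boxes-suc lo hi len eq rewrite eq = refl

  Σ-boxes : (lo hi : Fin n → ℤ) (len : Fin n → ℕ) → (∀ j → hi j - lo j ≡ + len j) → (F : Vec ℤ n → ℤ) →
            Σℤ (map F (boxes T k (tabulate (λ j → lo j , hi j))))
              ≡ ev F (tabulate (λ j → weighted (+ 1) (interval (lo j) (len j))))
  Σ-boxes {n = zero}  lo hi len eq F = ℤ.+-identityʳ (F [])
  Σ-boxes {n = suc n} lo hi len eq F = begin
    Σℤ (map F (boxes T k (tabulate (λ j → lo j , hi j))))
      ≡⟨ cong (Σℤ ∘ map F) (boxes-suc lo hi (len Fin.zero) (eq Fin.zero)) ⟩
    Σℤ (map F (concatMap (λ x → map (x ∷_) rest) (interval (lo Fin.zero) (len Fin.zero))))
      ≡⟨ Σ-concatMap F _ (interval (lo Fin.zero) (len Fin.zero)) ⟩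
    Σℤ (map (λ x → Σℤ (map F (map (x ∷_) rest))) (interval (lo Fin.zero) (len Fin.zero)))
      ≡⟨ cong Σℤ (List.map-cong (λ x → trans (cong Σℤ (sym (List.map-∘ rest)))
           (Σ-boxes (lo ∘ Fin.suc) (hi ∘ Fin.suc) (len ∘ Fin.suc) (eq ∘ Fin.suc) (F ∘ (x ∷_))))
           (interval (lo Fin.zero) (len Fin.zero))) ⟩
    Σℤ (map f (interval (lo Fin.zero) (len Fin.zero)))
      ≡⟨ ℤ.*-identityˡ _ ⟨
    + 1 * Σℤ (map f (interval (lo Fin.zero) (len Fin.zero)))
      ≡⟨ apply-weighted (+ 1) (interval (lo Fin.zero) (len Fin.zero)) f ⟨
    apply (weighted (+ 1) (interval (lo Fin.zero) (len Fin.zero))) f ∎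
    where
    rest = boxes T k (tabulate (λ j → lo (Fin.suc j) , hi (Fin.suc j)))
    f : ℤ → ℤ
    f x = ev (F ∘ (x ∷_)) (tabulate (λ j → weighted (+ 1) (interval (lo (Fin.suc j)) (len (Fin.suc j)))))

  ∈-boxes⁻ : (lo hi : Fin n → ℤ) (len : Fin n → ℕ) → (∀ j → hi j - lo j ≡ + len j) → ∀ {l} →
             l ∈ boxes T k (tabulate (λ j → lo j , hi j)) →
             ∀ j → ∃ λ i → i ℕ.< len j × lookup l j ≡ lo j + + i
  ∈-boxes⁻ {n = suc n} lo hi len eq {l} l∈ j
    with x , x∈ , l∈′ ← find (∈-concatMap⁻ _ {xs = interval (lo Fin.zero) (len Fin.zero)}
                          (subst (l ∈_) (boxes-suc lo hi (len Fin.zero) (eq Fin.zero)) l∈))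
    with l′ , l′∈ , refl ← ∈-map⁻ (x ∷_) l∈′
    with j
  ... | Fin.suc j = ∈-boxes⁻ (lo ∘ Fin.suc) (hi ∘ Fin.suc) (len ∘ Fin.suc) (eq ∘ Fin.suc) l′∈ j
  ... | Fin.zero with i , i∈ , refl ← ∈-map⁻ (λ i → lo Fin.zero + + i) x∈ = i , ∈-upTo⁻ i∈ , refl

  edgeLength : Fin m → ℕ
  edgeLength j = ℤ.∣ highE T k j - lowE T k j ∣

  lowE≤highE : ∀ j → lowE T k j ℤ.≤ highE T k j
  lowE≤highE j with kv T k (head T j) ℤ.≤ᵇ kv T k (tail T j) in eq
  ... | true  = ℤ.≤ᵇ⇒≤ (Equivalence.from Bool.T-≡ eq)
  ... | false = ℤ.<⇒≤ (ℤ.≰⇒> λ le → contradiction (trans (sym (Equivalence.to Bool.T-≡ (ℤ.≤⇒≤ᵇ le))) eq) λ ())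

  edgeLength-spec : ∀ j → highE T k j - lowE T k j ≡ + edgeLength j
  edgeLength-spec j = sym (ℤ.0≤i⇒+∣i∣≡i (ℤ.i≤j⇒0≤j-i (lowE≤highE j)))

  lowE+edgeLength : ∀ j → lowE T k j + + edgeLength j ≡ highE T k j
  lowE+edgeLength j = trans (cong (_+_ (lowE T k j)) (sym (edgeLength-spec j))) (ring (lowE T k j) (highE T k j))
    where
    ring : ∀ l h → l + (h - l) ≡ h
    ring = solve-∀

  lowerBound upperBound : Fin m → ℤ
  lowerBound j = lowE T k j - + suc (toℕ j)
  upperBound j = highE T k j - + suc (toℕ j)

  bounds-difference : ∀ j → upperBound j - lowerBound j ≡ + edgeLength j
  bounds-difference j = trans (ring (highE T k j) (lowE T k j) (+ suc (toℕ j))) (edgeLength-spec j)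
    where
    ring : ∀ h l s → h - s - (l - s) ≡ h - l
    ring = solve-∀

  unshift : ∀ l s i → l - s + i + s ≡ l + i
  unshift = solve-∀

  candidates-admissible : All (λ l → admissible T k l ≡ true) (candidates T k)
  candidates-admissible = All.tabulate λ {l} l∈ →
    and-intro _ (λ j → edge-admissible l j (∈-boxes⁻ lowerBound upperBound edgeLength bounds-difference l∈ j)) (allFin m)
    where
    and-intro : (p : A → Bool) → (∀ a → p a ≡ true) → ∀ l → and (map p l) ≡ true
    and-intro p all []      = refl
    and-intro p all (a ∷ l) = cong₂ _∧_ (all a) (and-intro p all l)
    edge-admissible : ∀ l j → (∃ λ i → i ℕ.< edgeLength j × lookup l j ≡ lowerBound j + + i) →
      ((lowE T k j ℤ.≤ᵇ (lookup l j + + suc (toℕ j))) ∧ ((lookup l j + + suc (toℕ j)) <ᵇ highE T k j)) ≡ true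
    edge-admissible l j (i , i< , eq)
      rewrite trans (cong (_+ + suc (toℕ j)) eq) (unshift (lowE T k j) (+ suc (toℕ j)) (+ i))
      = cong₂ _∧_
        (Equivalence.to Bool.T-≡ (ℤ.≤⇒≤ᵇ (ℤ.i≤i+j (lowE T k j) (+ i))))
        (cong not (Bool.¬-not (λ above → ℤ.<⇒≱ below (ℤ.≤ᵇ⇒≤ (Equivalence.from Bool.T-≡ above)))))
      where
      below : lowE T k j + + i ℤ.< highE T k j
      below = subst (lowE T k j + + i ℤ.<_) (lowE+edgeLength j) (ℤ.+-monoʳ-< (lowE T k j) (ℤ.+<+ i<))

  -- With the filter acting as the identity, the sum runs over a full box and factors edge by edge.
  admissibles≡candidates : admissibles T k ≡ candidates T k
  admissibles≡candidates = filterᵇ-all (candidates T k) candidates-admissible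
    where
    filterᵇ-all : ∀ l → All (λ l → admissible T k l ≡ true) l → filterᵇ (admissible T k) l ≡ l
    filterᵇ-all []      All.[]         = refl
    filterᵇ-all (a ∷ l) (eq All.∷ eqs) rewrite eq = cong (a ∷_) (filterᵇ-all l eqs)

  edgeSign : Fin m → ℤ
  edgeSign j = if isInversion T k j then - + 1 else + 1

  -- These are the oriented integral from the tail to the head of an edge, and the difference of the
  -- values at its ends.
  edgeInterval edgeDifference : Fin m → Comb ℤ
  edgeInterval j   = weighted (edgeSign j) (interval (lowE T k j) (edgeLength j))
  edgeDifference j = (+ 1 , kv T k (head T j)) ∷ (- + 1 , kv T k (tail T j)) ∷ []

  -- Each edge sign is inserted twice: one copy orients the interval, the other joins the global
  -- sign of the inversions.
  Σ-admissibles : (F : Vec ℤ m → ℤ) →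
    Σℤ (map (F ∘ shifted) (admissibles T k)) ≡ negOnePow (inversions T k) * ev F (tabulate edgeInterval)
  Σ-admissibles F = begin
    Σℤ (map (F ∘ shifted) (admissibles T k))
      ≡⟨ cong (Σℤ ∘ map (F ∘ shifted)) admissibles≡candidates ⟩
    Σℤ (map (F ∘ shifted) (boxes T k (tabulate (λ j → lowerBound j , upperBound j))))
      ≡⟨ Σ-boxes lowerBound upperBound edgeLength bounds-difference (F ∘ shifted) ⟩
    ev (F ∘ shifted) (tabulate (λ j → weighted (+ 1) (interval (lowerBound j) (edgeLength j))))
      ≡⟨ ev-rows (λ j y → y + + suc (toℕ j)) edgeSign
           (λ j → weighted (+ 1) (interval (lowerBound j) (edgeLength j))) edgeInterval signed-interval F ⟩
    Πℤ (map edgeSign (allFin m)) * ev F (tabulate edgeInterval)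
      ≡⟨ cong (_* ev F (tabulate edgeInterval)) (negOnePow-countFin (isInversion T k)) ⟨
    negOnePow (inversions T k) * ev F (tabulate edgeInterval) ∎
    where
    sign-cancel : ∀ b a → a ≡ (if b then - + 1 else + 1) * ((if b then - + 1 else + 1) * a)
    sign-cancel true  = ring
      where
      ring : ∀ a → a ≡ - + 1 * (- + 1 * a)
      ring = solve-∀
    sign-cancel false a = sym (trans (ℤ.*-identityˡ _) (ℤ.*-identityˡ a))
    signed-interval : ∀ j f →
      apply (weighted (+ 1) (interval (lowerBound j) (edgeLength j))) (λ y → f (y + + suc (toℕ j)))
        ≡ edgeSign j * apply (edgeInterval j) f
    signed-interval j f = begin
      apply (weighted (+ 1) (interval (lowerBound j) (edgeLength j))) (λ y → f (y + + suc (toℕ j)))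
        ≡⟨ trans (apply-weighted (+ 1) (interval (lowerBound j) (edgeLength j)) (λ y → f (y + + suc (toℕ j))))
             (ℤ.*-identityˡ (Σℤ (map (λ y → f (y + + suc (toℕ j))) (interval (lowerBound j) (edgeLength j))))) ⟩
      Σℤ (map (λ y → f (y + + suc (toℕ j))) (interval (lowerBound j) (edgeLength j)))
        ≡⟨ cong Σℤ (trans (sym (List.map-∘ (List.upTo (edgeLength j))))
             (trans (List.map-cong (λ i → cong f (unshift (lowE T k j) (+ suc (toℕ j)) (+ i)))
               (List.upTo (edgeLength j))) (List.map-∘ (List.upTo (edgeLength j))))) ⟩
      Σℤ (map f (interval (lowE T k j) (edgeLength j)))
        ≡⟨ sign-cancel (isInversion T k j) (Σℤ (map f (interval (lowE T k j) (edgeLength j)))) ⟩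
      edgeSign j * (edgeSign j * Σℤ (map f (interval (lowE T k j) (edgeLength j))))
        ≡⟨ cong (edgeSign j *_) (apply-weighted (edgeSign j) (interval (lowE T k j) (edgeLength j)) f) ⟨
      edgeSign j * apply (edgeInterval j) f ∎

  edgeDifference-falling : ∀ j i →
    apply (edgeDifference j) (falling (suc i)) ≡ + suc i * apply (edgeInterval j) (falling i)
  edgeDifference-falling j i = begin
    + 1 * f (kv T k (head T j)) + (- + 1 * f (kv T k (tail T j)) + + 0)
      ≡⟨ orient (isInversion T k j) (kv T k (head T j)) (kv T k (tail T j)) ⟩
    edgeSign j * (f (highE T k j) - f (lowE T k j))
      ≡⟨ cong (λ z → edgeSign j * (f z - f (lowE T k j))) (lowE+edgeLength j) ⟨
    edgeSign j * (f (lowE T k j + + edgeLength j) - f (lowE T k j))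
      ≡⟨ cong (edgeSign j *_) (Σ-falling i (lowE T k j) (edgeLength j)) ⟨
    edgeSign j * (+ suc i * s)
      ≡⟨ swap (edgeSign j) (+ suc i) s ⟩
    + suc i * (edgeSign j * s)
      ≡⟨ cong (+ suc i *_) (apply-weighted (edgeSign j) (interval (lowE T k j) (edgeLength j)) (falling i)) ⟨
    + suc i * apply (edgeInterval j) (falling i) ∎
    where
    f = falling (suc i)
    s = Σℤ (map (falling i) (interval (lowE T k j) (edgeLength j)))
    swap : ∀ a b c → a * (b * c) ≡ b * (a * c)
    swap = solve-∀
    orient : ∀ b h t → + 1 * f h + (- + 1 * f t + + 0)
      ≡ (if b then - + 1 else + 1) * (f (if b then t else h) - f (if b then h else t))
    orient true  h t = ring (f h) (f t)
      where
      ring : ∀ u v → + 1 * u + (- + 1 * v + + 0) ≡ - + 1 * (v - u)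
      ring = solve-∀
    orient false h t = ring (f h) (f t)
      where
      ring : ∀ u v → + 1 * u + (- + 1 * v + + 0) ≡ + 1 * (u - v)
      ring = solve-∀

  -- Only the constant entry 1 of the first row contributes, so `x₀` is free; the expansion over the
  -- tree later takes the coordinate of the root.
  ev-edgeDifference : (x₀ : ℤ) →
    ev V (((+ 1 , x₀) ∷ []) ∷ tabulate edgeDifference) ≡ factorial m * ev V (tabulate edgeInterval)
  ev-edgeDifference x₀ = begin
    ev V (((+ 1 , x₀) ∷ []) ∷ tabulate edgeDifference)
      ≡⟨ cong (λ φs → ev V (((+ 1 , x₀) ∷ []) ∷ φs)) (Vec.tabulate-∘ edgeDifference id) ⟩
    ev V (((+ 1 , x₀) ∷ []) ∷ Vec.map edgeDifference (Vec.allFin m))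
      ≡⟨ Antidifference.ev-V-φ₀∷φ edgeDifference edgeInterval ((+ 1 , x₀) ∷ [])
           (λ _ → refl) edgeDifference-falling refl (Vec.allFin m) ⟩
    factorial m * ev V (Vec.map edgeInterval (Vec.allFin m))
      ≡⟨ cong (λ φs → factorial m * ev V φs) (Vec.tabulate-∘ edgeInterval id) ⟨
    factorial m * ev V (tabulate edgeInterval) ∎

-- Expanding a product of differences

difference : A → A → Comb A
difference u w = (+ 1 , u) ∷ (- + 1 , w) ∷ []

Choice : (u w : Fin n → A) → Vec A n → Set
Choice u w xs = ∀ j → lookup xs j ≡ u j ⊎ lookup xs j ≡ w j

choose : {u w : Fin (suc n) → A} {a : A} {xs : Vec A n} → a ≡ u Fin.zero ⊎ a ≡ w Fin.zero →
         Choice (u ∘ Fin.suc) (w ∘ Fin.suc) xs → Choice u w (a ∷ xs)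
choose a? rest Fin.zero    = a?
choose a? rest (Fin.suc j) = rest j

ev-difference-zero : (u w : Fin n → A) (F : Vec A n → ℤ) → (∀ xs → Choice u w xs → F xs ≡ + 0) →
                     ev F (tabulate (λ j → difference (u j) (w j))) ≡ + 0
ev-difference-zero {n = zero}  u w F F≡0 = F≡0 [] λ ()
ev-difference-zero {n = suc n} u w F F≡0 = cong₂ (λ a b → + 1 * a + (- + 1 * b + + 0))
  (ev-difference-zero (u ∘ Fin.suc) (w ∘ Fin.suc) _ (λ xs c → F≡0 _ (choose (inj₁ refl) c)))
  (ev-difference-zero (u ∘ Fin.suc) (w ∘ Fin.suc) _ (λ xs c → F≡0 _ (choose (inj₂ refl) c)))

-- A term that takes some `w j` must vanish, since otherwise `unique` would identify `w j` with
-- `u j`. The one remaining term takes every `u j`, with coefficient 1.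
ev-difference-unique : (u w : Fin n → A) → (∀ j → u j ≢ w j) → (F : Vec A n → ℤ) →
                       (∀ xs → Choice u w xs → F xs ≢ + 0 → ∀ j → lookup xs j ≡ u j) →
                       ev F (tabulate (λ j → difference (u j) (w j))) ≡ F (tabulate u)
ev-difference-unique {n = zero}  u w u≢w F unique = refl
ev-difference-unique {n = suc n} u w u≢w F unique = begin
  + 1 * ev (F ∘ (u Fin.zero ∷_)) rest + (- + 1 * ev (F ∘ (w Fin.zero ∷_)) rest + + 0)
    ≡⟨ cong₂ (λ a b → + 1 * a + (- + 1 * b + + 0))
         (ev-difference-unique (u ∘ Fin.suc) (w ∘ Fin.suc) (u≢w ∘ Fin.suc) _
           (λ xs c F≢0 j → unique _ (choose (inj₁ refl) c) F≢0 (Fin.suc j)))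
         (ev-difference-zero (u ∘ Fin.suc) (w ∘ Fin.suc) (F ∘ (w Fin.zero ∷_)) zero-w) ⟩
  + 1 * F (tabulate u) + + 0
    ≡⟨ trans (ℤ.+-identityʳ _) (ℤ.*-identityˡ _) ⟩
  F (tabulate u) ∎
  where
  rest = tabulate (λ j → difference (u (Fin.suc j)) (w (Fin.suc j)))
  zero-w : ∀ xs → Choice (u ∘ Fin.suc) (w ∘ Fin.suc) xs → F (w Fin.zero ∷ xs) ≡ + 0
  zero-w xs c with F (w Fin.zero ∷ xs) ℤ.≟ + 0
  ... | yes F≡0 = F≡0
  ... | no F≢0  = contradiction (sym (unique _ (choose (inj₂ refl) c) F≢0 Fin.zero)) (u≢w Fin.zero)

V-repeat : (x : Fin n → ℤ) {i j : Fin n} → i ≢ j → x i ≡ x j → V (tabulate x) ≡ + 0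
V-repeat {suc n} x {Fin.zero}  {Fin.zero}  i≢j eq = contradiction refl i≢j
V-repeat {suc n} x {Fin.zero}  {Fin.suc j} i≢j eq = cong (_* V (tabulate (x ∘ Fin.suc)))
  (Π-zero (x ∘ Fin.suc) j (trans (cong (_- x Fin.zero) (sym eq)) (ℤ.+-inverseʳ (x Fin.zero))))
  where
  Π-zero : ∀ {n} (y : Fin n → ℤ) j → y j - x Fin.zero ≡ + 0 →
           Πℤ (map (λ z → z - x Fin.zero) (toList (tabulate y))) ≡ + 0
  Π-zero y Fin.zero    eq = cong (_* Πℤ (map (λ z → z - x Fin.zero) (toList (tabulate (y ∘ Fin.suc))))) eq
  Π-zero y (Fin.suc j) eq =
    trans (cong ((y Fin.zero - x Fin.zero) *_) (Π-zero (y ∘ Fin.suc) j eq)) (ℤ.*-zeroʳ (y Fin.zero - x Fin.zero))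
V-repeat {suc n} x {Fin.suc i} {Fin.zero}  i≢j eq = V-repeat x (i≢j ∘ sym) (sym eq)
V-repeat {suc n} x {Fin.suc i} {Fin.suc j} i≢j eq = trans
  (cong (Πℤ (map (λ z → z - x Fin.zero) (toList (tabulate (x ∘ Fin.suc)))) *_)
    (V-repeat (x ∘ Fin.suc) (i≢j ∘ cong Fin.suc) eq))
  (ℤ.*-zeroʳ (Πℤ (map (λ z → z - x Fin.zero) (toList (tabulate (x ∘ Fin.suc))))))

-- The expansion over a tree

module _ (T : Tree m) (x : Fin (suc m) → ℤ) where

  private
    -- Terms are indexed by vertices rather than coordinates: the two ends of an edge are distinct
    -- vertices even when their coordinates agree.
    F : Vec (Fin (suc m)) m → ℤ
    F c = V (x Fin.zero ∷ tabulate (λ j → x (lookup c j)))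

  edgeFlip : Fin m → ℤ
  edgeFlip j = if not ⌊ stdHead T j Fin.≟ head T j ⌋ then - + 1 else + 1

  std-difference : ∀ j (f : ℤ → ℤ) →
    apply (difference (stdHead T j) (stdTail T j)) (f ∘ x)
      ≡ edgeFlip j * apply (difference (x (head T j)) (x (tail T j))) f
  std-difference j f with stdEnds
    where
    stdEnds : (stdHead T j ≡ head T j × stdTail T j ≡ tail T j) ⊎ (stdHead T j ≡ tail T j × stdTail T j ≡ head T j)
    stdEnds with dist T (tail T j) ℕ.<ᵇ dist T (head T j)
    ... | true  = inj₁ (refl , refl)
    ... | false = inj₂ (refl , refl)
  ... | inj₁ (h , t) = begin
    apply (difference (stdHead T j) (stdTail T j)) (f ∘ x)
      ≡⟨ cong₂ (λ u w → apply (difference u w) (f ∘ x)) h t ⟩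
    apply (difference (x (head T j)) (x (tail T j))) f
      ≡⟨ ℤ.*-identityˡ _ ⟨
    + 1 * apply (difference (x (head T j)) (x (tail T j))) f
      ≡⟨ cong (λ b → (if not b then - + 1 else + 1) * apply (difference (x (head T j)) (x (tail T j))) f)
           (⌊⌋-intro (stdHead T j Fin.≟ head T j) h) ⟨
    edgeFlip j * apply (difference (x (head T j)) (x (tail T j))) f ∎
  ... | inj₂ (h , t) = begin
    apply (difference (stdHead T j) (stdTail T j)) (f ∘ x)
      ≡⟨ cong₂ (λ u w → apply (difference u w) (f ∘ x)) h t ⟩
    + 1 * f (x (tail T j)) + (- + 1 * f (x (head T j)) + + 0)
      ≡⟨ ring (f (x (tail T j))) (f (x (head T j))) ⟩
    - + 1 * apply (difference (x (head T j)) (x (tail T j))) f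
      ≡⟨ cong (λ b → (if not b then - + 1 else + 1) * apply (difference (x (head T j)) (x (tail T j))) f)
           (Bool.¬-not (λ eq → stdHead≢stdTail T j
             (trans (⌊⌋-elim (stdHead T j Fin.≟ head T j) eq) (sym t)))) ⟨
    edgeFlip j * apply (difference (x (head T j)) (x (tail T j))) f ∎
    where
    ring : ∀ u v → + 1 * u + (- + 1 * v + + 0) ≡ - + 1 * (+ 1 * v + (- + 1 * u + + 0))
    ring = solve-∀

  -- A repeated vertex repeats a coordinate and annihilates `V`. A nonzero term therefore chooses
  -- distinct vertices other than the root, which only the ends away from the root achieve.
  F≢0⇒stdHead : ∀ c → Choice (stdHead T) (stdTail T) c → F c ≢ + 0 → ∀ j → lookup c j ≡ stdHead T j
  F≢0⇒stdHead c choice F≢0 = distinct-ends⇒stdHead T (lookup c) choice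
    (λ j eq → distinct {Fin.suc j} {Fin.zero} (λ ()) (cong x eq))
    (λ {i} {j} eq → lookup-injective i j eq)
    where
    y : Fin (suc m) → ℤ
    y Fin.zero    = x Fin.zero
    y (Fin.suc j) = x (lookup c j)
    distinct : ∀ {i j} → i ≢ j → y i ≢ y j
    distinct i≢j eq = F≢0 (V-repeat y i≢j eq)
    lookup-injective : ∀ i j → lookup c i ≡ lookup c j → i ≡ j
    lookup-injective i j eq with i Fin.≟ j
    ... | yes i≡j = i≡j
    ... | no i≢j  = contradiction (cong x eq) (distinct {Fin.suc i} {Fin.suc j} (i≢j ∘ Fin.suc-injective))

  ev-edges : ev V (((+ 1 , x Fin.zero) ∷ []) ∷ tabulate (λ j → difference (x (head T j)) (x (tail T j))))
               ≡ sgnTree T * V (tabulate x)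
  ev-edges = begin
    + 1 * E + + 0
      ≡⟨ trans (ℤ.+-identityʳ _) (ℤ.*-identityˡ E) ⟩
    E
      ≡⟨ negOnePow-cancel (reversed T) E ⟨
    negOnePow (reversed T) * (negOnePow (reversed T) * E)
      ≡⟨ cong (λ z → negOnePow (reversed T) * (z * E)) (negOnePow-countFin (λ j → not ⌊ stdHead T j Fin.≟ head T j ⌋)) ⟩
    negOnePow (reversed T) * (Πℤ (map edgeFlip (allFin m)) * E)
      ≡⟨ cong (negOnePow (reversed T) *_)
           (ev-rows (λ _ → x) edgeFlip (λ j → difference (stdHead T j) (stdTail T j))
             (λ j → difference (x (head T j)) (x (tail T j))) std-difference
             (V ∘ (x Fin.zero ∷_))) ⟨
    negOnePow (reversed T) * ev F (tabulate (λ j → difference (stdHead T j) (stdTail T j)))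
      ≡⟨ cong (negOnePow (reversed T) *_)
           (ev-difference-unique (stdHead T) (stdTail T) (stdHead≢stdTail T) F F≢0⇒stdHead) ⟩
    negOnePow (reversed T) * V (x Fin.zero ∷ tabulate (λ j → x (lookup (tabulate (stdHead T)) j)))
      ≡⟨ cong (λ xs → negOnePow (reversed T) * V (x Fin.zero ∷ xs))
           (Vec.tabulate-cong (λ j → cong x (Vec.lookup∘tabulate (stdHead T) j))) ⟩
    -- `π T` fixes index zero and lists the values of `stdHead T` after it, so the vector is the
    -- same by computation.
    negOnePow (reversed T) * V (tabulate (x ∘ π T))
      ≡⟨ cong (negOnePow (reversed T) *_) (V-π T x) ⟩
    negOnePow (reversed T) * (negOnePow (πInversions T) * V (tabulate x))
      ≡⟨ ℤ.*-assoc (negOnePow (reversed T)) (negOnePow (πInversions T)) (V (tabulate x)) ⟨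
    negOnePow (reversed T) * negOnePow (πInversions T) * V (tabulate x)
      ≡⟨ cong (_* V (tabulate x)) (negOnePow-+ (reversed T) (πInversions T)) ⟨
    sgnTree T * V (tabulate x) ∎
    where
    E = ev (V ∘ (x Fin.zero ∷_)) (tabulate (λ j → difference (x (head T j)) (x (tail T j))))

-- Induction on the order

-- The inversion sign and the tree sign each occur once on the left and once more from the
-- summation; being 1 or -1, both cancel.
Σ-admissibles-V : (T : Tree m) (k : Vec ℤ (suc m)) →
  negOnePow (inversions T k) * sgnTree T * (factorial m * Σℤ (map (V ∘ shifted) (admissibles T k)))
    ≡ V (tabulate (kv T k))
Σ-admissibles-V {m} T k = begin
  s * t * (factorial m * Σℤ (map (V ∘ shifted) (admissibles T k)))
    ≡⟨ cong (λ z → s * t * (factorial m * z)) (Σ-admissibles T k V) ⟩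
  s * t * (factorial m * (s * ev V (tabulate (edgeInterval T k))))
    ≡⟨ ring s t (factorial m) (ev V (tabulate (edgeInterval T k))) ⟩
  s * (s * (t * (factorial m * ev V (tabulate (edgeInterval T k)))))
    ≡⟨ negOnePow-cancel (inversions T k) _ ⟩
  t * (factorial m * ev V (tabulate (edgeInterval T k)))
    ≡⟨ cong (t *_) (ev-edgeDifference T k (kv T k Fin.zero)) ⟨
  t * ev V (((+ 1 , kv T k Fin.zero) ∷ []) ∷ tabulate (edgeDifference T k))
    ≡⟨ cong (t *_) (ev-edges T (kv T k)) ⟩
  t * (t * V (tabulate (kv T k)))
    ≡⟨ negOnePow-cancel (reversed T ℕ.+ πInversions T) (V (tabulate (kv T k))) ⟩
  V (tabulate (kv T k)) ∎
  where
  s = negOnePow (inversions T k)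
  t = sgnTree T
  ring : ∀ s t f e → s * t * (f * (s * e)) ≡ s * (s * (t * (f * e)))
  ring = solve-∀

Lₙ-suc : (𝒯 : TreeSeq (suc m)) (T : Tree (suc m)) (k : Vec ℤ (suc (suc m))) →
  Lₙ (𝒯 , T) k ≡ negOnePow (inversions T k) * sgnTree T * Σℤ (map (Lₙ 𝒯) (admissibles T k))
Lₙ-suc 𝒯 T k = begin
  Lₙ (𝒯 , T) k
    ≡⟨ Σ-concatMap (λ i → negOnePow i * (sgnSeq 𝒯 * sgnTree T))
         (λ l → map (inversions T k ℕ.+_) (gtInversions 𝒯 l)) (admissibles T k) ⟩
  Σℤ (map (λ l → Σℤ (map (λ i → negOnePow i * (sgnSeq 𝒯 * sgnTree T))
    (map (inversions T k ℕ.+_) (gtInversions 𝒯 l)))) (admissibles T k))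
    ≡⟨ cong Σℤ (List.map-cong (λ l → trans
         (cong Σℤ (trans (sym (List.map-∘ (gtInversions 𝒯 l))) (List.map-cong factor (gtInversions 𝒯 l))))
         (Σ-scale c (λ i → negOnePow i * sgnSeq 𝒯) (gtInversions 𝒯 l))) (admissibles T k)) ⟩
  Σℤ (map (λ l → c * Lₙ 𝒯 l) (admissibles T k))
    ≡⟨ Σ-scale c (Lₙ 𝒯) (admissibles T k) ⟩
  c * Σℤ (map (Lₙ 𝒯) (admissibles T k)) ∎
  where
  c = negOnePow (inversions T k) * sgnTree T
  ring : ∀ a b s t → a * b * (s * t) ≡ a * t * (b * s)
  ring = solve-∀
  factor : ∀ i → negOnePow (inversions T k ℕ.+ i) * (sgnSeq 𝒯 * sgnTree T) ≡ c * (negOnePow i * sgnSeq 𝒯)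
  factor i = trans (cong (_* (sgnSeq 𝒯 * sgnTree T)) (negOnePow-+ (inversions T k) i))
    (ring (negOnePow (inversions T k)) (negOnePow i) (sgnSeq 𝒯) (sgnTree T))

theorem1 : (m : ℕ) (𝒯 : TreeSeq (suc m)) (k : Vec ℤ (suc m)) →
    Lₙ 𝒯 k * denProd (suc m) ≡ numProd k
-- With one vertex there are no edges and no pairs: the sign is 1 and both sides compute to 1.
theorem1 zero    (tt , T) k = refl
theorem1 (suc m) (𝒯 , T)  k = begin
  Lₙ (𝒯 , T) k * denProd (suc (suc m))
    ≡⟨ cong₂ _*_ (Lₙ-suc 𝒯 T k) (denProd-suc (suc m)) ⟩
  c * Σℤ (map (Lₙ 𝒯) (admissibles T k)) * (factorial (suc m) * denProd (suc m))
    ≡⟨ ring c (Σℤ (map (Lₙ 𝒯) (admissibles T k))) (factorial (suc m)) (denProd (suc m)) ⟩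
  c * (factorial (suc m) * (denProd (suc m) * Σℤ (map (Lₙ 𝒯) (admissibles T k))))
    -- The denominator of the smaller order moves inside the sum, where the induction hypothesis
    -- clears it from each term.
    ≡⟨ cong (λ z → c * (factorial (suc m) * z)) (begin
         denProd (suc m) * Σℤ (map (Lₙ 𝒯) (admissibles T k))
           ≡⟨ Σ-scale (denProd (suc m)) (Lₙ 𝒯) (admissibles T k) ⟨
         Σℤ (map (λ l → denProd (suc m) * Lₙ 𝒯 l) (admissibles T k))
           ≡⟨ cong Σℤ (List.map-cong (λ l → trans (ℤ.*-comm (denProd (suc m)) (Lₙ 𝒯 l))
                (trans (theorem1 m 𝒯 l) (numProd-V l))) (admissibles T k)) ⟩
         Σℤ (map (V ∘ shifted) (admissibles T k)) ∎) ⟩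
  c * (factorial (suc m) * Σℤ (map (V ∘ shifted) (admissibles T k)))
    ≡⟨ Σ-admissibles-V T k ⟩
  V (tabulate (kv T k))
    ≡⟨ numProd-V k ⟨
  numProd k ∎
  where
  c = negOnePow (inversions T k) * sgnTree T
  ring : ∀ c s f d → c * s * (f * d) ≡ c * (f * (d * s))
  ring = solve-∀
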